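{- Let $1\le k\le d$ and $n\ge 1$ be integers, let $A\in\mathbb{R}^{n\times d}$ have rows $a_1,\dots,a_n$, and let $S\subseteq[n]$ and $\beta\ge 1$ be such that for every $k$-dimensional subspace $V\subseteq\mathbb{R}^d$, $$\max_{i\in S}d(a_i,V)\le\max_{i\in[n]}d(a_i,V)\le\beta\cdot\max_{i\in S}d(a_i,V).$$ Let $\tilde V$ be the top-$k$ right singular subspace of $A_S$, i.e. the span of the right singular vectors of $A_S$ corresponding to its $k$ largest singular values. Then $$\max_{i\in[n]}d(a_i,\tilde V)\le\beta\sqrt{|S|}\cdot\min_{k\text{ -dim }V}\max_{i\in[n]}d(a_i,V),$$ i.e. $\tilde V$ is a $\beta\sqrt{|S|}$-approximate solution of the rank-$k$ $\ell_\infty$ subspace approximation problem on $A$.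
   Context: Notation: $[n]=\{1,\dots,n\}$; for $a\in\mathbb{R}^d$ and a subspace $V\subseteq\mathbb{R}^d$, $d(a,V)=\min_{v\in V}\|a-v\|_2$; $A_S$ is the submatrix of $A$ formed by the rows indexed by $S$ (a maximum over the empty set is $0$). The right singular vectors are taken from a full SVD, so that they form an orthonormal basis of $\mathbb{R}^d$, with missing singular values regarded as $0$. The minimum over "$k$-dim $V$" is over $k$-dimensional subspaces of $\mathbb{R}^d$. The rank-$k$ $\ell_\infty$ subspace approximation problem asks for a $k$-dimensional subspace $V$ minimizing $\max_{i\in[n]}d(a_i,V)$. -}

module Defs where

open import Algebra.Bundles using (CommutativeRing)
open import Algebra.Structures using (IsCommutativeRing)
import Algebra.Properties.Semiring.Sum
import Data.Integer as ℤ
import Data.Integer.Properties as ℤₚ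
import Data.Nat as ℕ
import Data.Nat.Properties as ℕₚ
open import Data.Bool using (if_then_else_)
open import Data.Empty using (⊥-elim)
open import Data.Fin using (Fin; zero; suc; toℕ; inject≤)
import Data.Fin as Fin
open import Data.Fin.Subset using (Subset; inside; outside; ∣_∣; _∈_; ⊤)
open import Data.Nat using (ℕ; zero; suc)
open import Data.Product using (Σ; ∃-syntax; _×_; _,_; proj₁; proj₂)
open import Data.Rational as ℚ using (ℚ; 0ℚ; 1ℚ; ½; positive; nonNegative; 1/_) hiding (module ℚ)
import Data.Rational.Properties as ℚₚ
open import Data.Rational.Solver using (module +-*-Solver)
import Data.Rational.Unnormalised as ℚᵘ
import Data.Rational.Unnormalised.Properties as ℚᵘₚ
open import Data.Sum using (inj₁; inj₂)
open import Data.Vec using ([]; _∷_)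
open import Data.Vec.Functional using (Vector)
open import Function using (_∘_)
open import Level using (Level; 0ℓ)
open import Relation.Binary.PropositionalEquality using (_≡_; refl; sym; trans; cong; cong₂; subst)
open import Relation.Binary.Structures using (IsEquivalence)
open import Relation.Nullary using (Dec; yes; no)

module RationalFacts where
  open ℚ using (_+_; _*_; _-_; -_; _⊔_; _≤_; _<_)
  open +-*-Solver

  ∣_∣ℚ : ℚ → ℚ
  ∣_∣ℚ = ℚ.∣_∣

  half+half : ∀ ε → ½ * ε + ½ * ε ≡ ε
  half+half ε = trans (sym (ℚₚ.*-distribʳ-+ ε ½ ½)) (ℚₚ.*-identityˡ ε)

  half-pos : ∀ {ε} → 0ℚ < ε → 0ℚ < ½ * ε
  half-pos {ε} ε>0 = ℚₚ.positive⁻¹ (½ * ε) {{ℚₚ.pos*pos⇒pos ½ ε {{positive ε>0}}}}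

  *-pos : ∀ {p q} → 0ℚ < p → 0ℚ < q → 0ℚ < p * q
  *-pos {p} {q} p>0 q>0 =
    ℚₚ.positive⁻¹ (p * q) {{ℚₚ.pos*pos⇒pos p {{positive p>0}} q {{positive q>0}}}}

  *-nonneg : ∀ {p q} → 0ℚ ≤ p → 0ℚ ≤ q → 0ℚ ≤ p * q
  *-nonneg {p} {q} p≥0 q≥0 =
    ℚₚ.nonNegative⁻¹ (p * q) {{ℚₚ.nonNeg*nonNeg⇒nonNeg p {{nonNegative p≥0}} q {{nonNegative q≥0}}}}

  *-mono : ∀ {a b c d} → 0ℚ ≤ a → 0ℚ ≤ d → a ≤ b → c ≤ d → a * c ≤ b * d
  *-mono {a} {b} {c} {d} a≥0 d≥0 a≤b c≤d = ℚₚ.≤-trans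
    (ℚₚ.*-monoˡ-≤-nonNeg a {{nonNegative a≥0}} c≤d)
    (ℚₚ.*-monoʳ-≤-nonNeg d {{nonNegative d≥0}} a≤b)

  <-+-pos : ∀ p {e} → 0ℚ < e → p < p + e
  <-+-pos p e>0 = subst (_< p + _) (ℚₚ.+-identityʳ p) (ℚₚ.+-monoʳ-< p e>0)

  ≤-+-nonneg : ∀ p {e} → 0ℚ ≤ e → p ≤ p + e
  ≤-+-nonneg p e≥0 = subst (_≤ p + _) (ℚₚ.+-identityʳ p) (ℚₚ.+-monoʳ-≤ p e≥0)

  1>0 : 0ℚ < 1ℚ
  1>0 = ℚₚ.positive⁻¹ 1ℚ

  square-cancel-≤ : ∀ {p q} → 0ℚ ≤ q → p * p ≤ q * q → p ≤ q
  square-cancel-≤ {p} {q} q≥0 p²≤q² with p ℚₚ.≤? q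
  ... | yes p≤q = p≤q
  ... | no p≰q = ⊥-elim (ℚₚ.<-irrefl refl (ℚₚ.<-≤-trans q²<p² p²≤q²))
    where
    q<p = ℚₚ.≰⇒> p≰q
    q²<p² : q * q < p * p
    q²<p² = ℚₚ.≤-<-trans
      (ℚₚ.*-monoˡ-≤-nonNeg q {{nonNegative q≥0}} (ℚₚ.<⇒≤ q<p))
      (ℚₚ.*-monoˡ-<-pos p {{positive (ℚₚ.≤-<-trans q≥0 q<p)}} q<p)

  diff≤⇒≤+ : ∀ p q {e} → p - q ≤ e → p ≤ q + e
  diff≤⇒≤+ p q p-q≤e = subst (_≤ q + _)
    (solve 2 (λ x y → y :+ (x :- y) := x) refl p q) (ℚₚ.+-monoʳ-≤ q p-q≤e)

  ≤+⇒diff≤ : ∀ p q {e} → p ≤ q + e → p - q ≤ e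
  ≤+⇒diff≤ p q {e} p≤q+e = subst (p - q ≤_)
    (solve 2 (λ y z → (y :+ z) :- y := z) refl q e) (ℚₚ.+-monoˡ-≤ (- q) p≤q+e)

  p≤∣p∣ : ∀ p → p ≤ ∣ p ∣ℚ
  p≤∣p∣ p with ℚₚ.≤-total 0ℚ p
  ... | inj₁ 0≤p = ℚₚ.≤-reflexive (sym (ℚₚ.0≤p⇒∣p∣≡p 0≤p))
  ... | inj₂ p≤0 = ℚₚ.≤-trans p≤0 (ℚₚ.0≤∣p∣ p)

  ∣-∣-comm : ∀ p q → ∣ p - q ∣ℚ ≡ ∣ q - p ∣ℚ
  ∣-∣-comm p q = trans (sym (ℚₚ.∣-p∣≡∣p∣ (p - q)))
    (cong ∣_∣ℚ (solve 2 (λ x y → :- (x :- y) := y :- x) refl p q))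

  dist⇒≤+ : ∀ p q {e} → ∣ p - q ∣ℚ ≤ e → p ≤ q + e
  dist⇒≤+ p q d≤e = diff≤⇒≤+ p q (ℚₚ.≤-trans (p≤∣p∣ (p - q)) d≤e)

  dist⇒≥+ : ∀ p q {e} → ∣ p - q ∣ℚ ≤ e → q ≤ p + e
  dist⇒≥+ p q d≤e = dist⇒≤+ q p (subst (_≤ _) (∣-∣-comm p q) d≤e)

  ≤+⇒dist : ∀ p q {e} → p ≤ q + e → q ≤ p + e → ∣ p - q ∣ℚ ≤ e
  ≤+⇒dist p q p≤q+e q≤p+e with ℚₚ.∣p∣≡p∨∣p∣≡-p (p - q)
  ... | inj₁ eq = subst (_≤ _) (sym eq) (≤+⇒diff≤ p q p≤q+e)
  ... | inj₂ eq = subst (_≤ _)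
    (sym (trans eq (solve 2 (λ x y → :- (x :- y) := y :- x) refl p q)))
    (≤+⇒diff≤ q p q≤p+e)

  dist-refl : ∀ p {e} → 0ℚ ≤ e → ∣ p - p ∣ℚ ≤ e
  dist-refl p e≥0 = ≤+⇒dist p p (≤-+-nonneg p e≥0) (≤-+-nonneg p e≥0)

  dist-trans : ∀ p q r {e f} → ∣ p - q ∣ℚ ≤ e → ∣ q - r ∣ℚ ≤ f → ∣ p - r ∣ℚ ≤ e + f
  dist-trans p q r d≤e d≤f = ℚₚ.≤-trans
    (subst (λ z → ∣ z ∣ℚ ≤ ∣ p - q ∣ℚ + ∣ q - r ∣ℚ)
      (solve 3 (λ x y z → (x :- y) :+ (y :- z) := x :- z) refl p q r)
      (ℚₚ.∣p+q∣≤∣p∣+∣q∣ (p - q) (q - r)))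
    (ℚₚ.+-mono-≤ d≤e d≤f)

  dist-+ : ∀ a b c d {e f} → ∣ a - c ∣ℚ ≤ e → ∣ b - d ∣ℚ ≤ f →
           ∣ (a + b) - (c + d) ∣ℚ ≤ e + f
  dist-+ a b c d h k = ℚₚ.≤-trans
    (subst (λ z → ∣ z ∣ℚ ≤ ∣ a - c ∣ℚ + ∣ b - d ∣ℚ)
      (solve 4 (λ a b c d → (a :- c) :+ (b :- d) := (a :+ b) :- (c :+ d)) refl a b c d)
      (ℚₚ.∣p+q∣≤∣p∣+∣q∣ (a - c) (b - d)))
    (ℚₚ.+-mono-≤ h k)

  dist-neg : ∀ a b {e} → ∣ a - b ∣ℚ ≤ e → ∣ - a - - b ∣ℚ ≤ e
  dist-neg a b h = subst (_≤ _)
    (trans (sym (ℚₚ.∣-p∣≡∣p∣ (a - b)))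
      (cong ∣_∣ℚ (solve 2 (λ a b → :- (a :- b) := (:- a) :- (:- b)) refl a b))) h

  dist-⊔ : ∀ a b c d {e} → ∣ a - c ∣ℚ ≤ e → ∣ b - d ∣ℚ ≤ e → ∣ (a ⊔ b) - (c ⊔ d) ∣ℚ ≤ e
  dist-⊔ a b c d h k = ≤+⇒dist (a ⊔ b) (c ⊔ d)
    (half⊔ a b c d (dist⇒≤+ a c h) (dist⇒≤+ b d k))
    (half⊔ c d a b (dist⇒≥+ a c h) (dist⇒≥+ b d k))
    where
    half⊔ : ∀ a b c d {e} → a ≤ c + e → b ≤ d + e → a ⊔ b ≤ (c ⊔ d) + e
    half⊔ a b c d {e} a≤ b≤ = ℚₚ.⊔-lub
      (ℚₚ.≤-trans a≤ (ℚₚ.+-monoˡ-≤ e (ℚₚ.p≤p⊔q c d)))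
      (ℚₚ.≤-trans b≤ (ℚₚ.+-monoˡ-≤ e (ℚₚ.p≤q⊔p c d)))

  dist-* : ∀ a b c d {K L e} → ∣ a ∣ℚ ≤ K → ∣ d ∣ℚ ≤ L → 0ℚ ≤ e →
           ∣ a - c ∣ℚ ≤ e → ∣ b - d ∣ℚ ≤ e → ∣ (a * b) - (c * d) ∣ℚ ≤ (K + L) * e
  dist-* a b c d {K} {L} {e} a≤K d≤L e≥0 h k = begin
    ∣ (a * b) - (c * d) ∣ℚ
      ≡⟨ cong ∣_∣ℚ (solve 4 (λ a b c d → (a :* b) :- (c :* d) := a :* (b :- d) :+ d :* (a :- c)) refl a b c d) ⟩
    ∣ a * (b - d) + d * (a - c) ∣ℚ
      ≤⟨ ℚₚ.∣p+q∣≤∣p∣+∣q∣ (a * (b - d)) (d * (a - c)) ⟩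
    ∣ a * (b - d) ∣ℚ + ∣ d * (a - c) ∣ℚ
      ≡⟨ cong₂ _+_ (ℚₚ.∣p*q∣≡∣p∣*∣q∣ a (b - d)) (ℚₚ.∣p*q∣≡∣p∣*∣q∣ d (a - c)) ⟩
    ∣ a ∣ℚ * ∣ b - d ∣ℚ + ∣ d ∣ℚ * ∣ a - c ∣ℚ
      ≤⟨ ℚₚ.+-mono-≤ (*-mono {∣ a ∣ℚ} {K} {∣ b - d ∣ℚ} {e} (ℚₚ.0≤∣p∣ a) e≥0 a≤K k)
                       (*-mono {∣ d ∣ℚ} {L} {∣ a - c ∣ℚ} {e} (ℚₚ.0≤∣p∣ d) e≥0 d≤L h) ⟩
    K * e + L * e
      ≡⟨ sym (ℚₚ.*-distribʳ-+ e K L) ⟩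
    (K + L) * e ∎
    where open ℚₚ.≤-Reasoning

  recip : (p : ℚ) → 0ℚ < p → ℚ
  recip p p>0 = (1/ p) {{ℚₚ.pos⇒nonZero p {{positive p>0}}}}

  recip-pos : ∀ p p>0 → 0ℚ < recip p p>0
  recip-pos p p>0 = ℚₚ.positive⁻¹ _ {{ℚₚ.1/pos⇒pos p {{positive p>0}}}}

  *-recip : ∀ p p>0 → p * recip p p>0 ≡ 1ℚ
  *-recip p p>0 = ℚₚ.*-inverseʳ p {{ℚₚ.pos⇒nonZero p {{positive p>0}}}}

  ι : ℕ → ℚ
  ι n = ℤ.+ n ℚ./ 1

  ι-suc : ∀ n → ι (suc n) ≡ 1ℚ + ι n
  ι-suc n = ℚₚ.toℚᵘ-injective (begin
    ℚ.toℚᵘ (ι (suc n))                  ≈⟨ ℚₚ.toℚᵘ-fromℚᵘ (ℚᵘ.mkℚᵘ (ℤ.+ suc n) 0) ⟩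
    ℚᵘ.mkℚᵘ (ℤ.+ suc n) 0               ≈⟨ ℚᵘ.*≡* (cong (ℤ._* ℤ.1ℤ) (lemma n)) ⟩
    ℚᵘ.1ℚᵘ ℚᵘ.+ ℚᵘ.mkℚᵘ (ℤ.+ n) 0       ≈⟨ ℚᵘₚ.+-cong (ℚᵘₚ.≃-refl {ℚᵘ.1ℚᵘ}) (ℚᵘₚ.≃-sym (ℚₚ.toℚᵘ-fromℚᵘ (ℚᵘ.mkℚᵘ (ℤ.+ n) 0))) ⟩
    ℚ.toℚᵘ 1ℚ ℚᵘ.+ ℚ.toℚᵘ (ι n)         ≈⟨ ℚᵘₚ.≃-sym (ℚₚ.toℚᵘ-homo-+ 1ℚ (ι n)) ⟩
    ℚ.toℚᵘ (1ℚ + ι n)                   ∎)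
    where
    open ℚᵘₚ.≃-Reasoning
    lemma : ∀ n → ℤ.+ suc n ≡ ℤ.1ℤ ℤ.* ℤ.1ℤ ℤ.+ (ℤ.+ n) ℤ.* ℤ.1ℤ
    lemma n = cong (λ z → ℤ.1ℤ ℤ.+ z) (sym (ℤₚ.*-identityʳ (ℤ.+ n)))

  ι-nonneg : ∀ n → 0ℚ ≤ ι n
  ι-nonneg n = ℚₚ.nonNegative⁻¹ (ι n) {{ℚₚ.normalize-nonNeg n 1}}

  ι-pos : ∀ n → 0ℚ < ι (suc n)
  ι-pos n = ℚₚ.positive⁻¹ (ι (suc n)) {{ℚₚ.normalize-pos (suc n) 1}}

  ι-step : ∀ n → ι n ≤ ι (suc n)
  ι-step n = subst (ι n ≤_) (trans (ℚₚ.+-comm (ι n) 1ℚ) (sym (ι-suc n)))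
    (≤-+-nonneg (ι n) (ℚₚ.<⇒≤ 1>0))

  ι-mono : ∀ {m n} → m ℕ.≤ n → ι m ≤ ι n
  ι-mono m≤n = go (ℕₚ.≤⇒≤′ m≤n)
    where
    go : ∀ {m n} → m ℕ.≤′ n → ι m ≤ ι n
    go ℕ.≤′-refl = ℚₚ.≤-refl
    go (ℕ.≤′-step {n} m≤n) = ℚₚ.≤-trans (go m≤n) (ι-step n)

  archimedean : ∀ q → ∃[ n ] q ≤ ι n
  archimedean q@(ℚ.mkℚ i d _) = ℤ.∣ i ∣ , ℚₚ.toℚᵘ-cancel-≤ (ℚᵘₚ.≤-trans
    (ℚᵘ.*≤* (bound i))
    (ℚᵘₚ.≤-reflexive (ℚᵘₚ.≃-sym (ℚₚ.toℚᵘ-fromℚᵘ (ℚᵘ.mkℚᵘ (ℤ.+ ℤ.∣ i ∣) 0)))))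
    where
    bound : ∀ i → i ℤ.* ℤ.1ℤ ℤ.≤ (ℤ.+ ℤ.∣ i ∣) ℤ.* (ℤ.+ suc d)
    bound (ℤ.+ n) rewrite ℤₚ.*-identityʳ (ℤ.+ n) | sym (ℤₚ.pos-* n (suc d)) =
      ℤ.+≤+ (ℕₚ.m≤m*n n (suc d))
    bound ℤ.-[1+ n ] rewrite ℤₚ.*-identityʳ ℤ.-[1+ n ] | sym (ℤₚ.pos-* (suc n) (suc d)) = ℤ.-≤+

  mesh : ℕ → ℚ
  mesh n = recip (ι (suc n)) (ι-pos n)

  mesh-pos : ∀ n → 0ℚ < mesh n
  mesh-pos n = recip-pos (ι (suc n)) (ι-pos n)

  mesh-small : ∀ ε → 0ℚ < ε → ∃[ N ] ∀ n → N ℕ.≤ n → mesh n ≤ ε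
  mesh-small ε ε>0 with archimedean (recip ε ε>0)
  ... | N , 1/ε≤N = N , λ n N≤n → begin
      mesh n                         ≡⟨ sym (ℚₚ.*-identityʳ (mesh n)) ⟩
      mesh n * 1ℚ                    ≡⟨ cong (mesh n *_) (sym (*-recip ε ε>0)) ⟩
      mesh n * (ε * recip ε ε>0)     ≤⟨ ℚₚ.*-monoˡ-≤-nonNeg (mesh n) {{nonNegative (ℚₚ.<⇒≤ (mesh-pos n))}}
                                          (ℚₚ.*-monoˡ-≤-nonNeg ε {{nonNegative (ℚₚ.<⇒≤ ε>0)}}
                                            (ℚₚ.≤-trans 1/ε≤N (ι-mono (ℕₚ.≤-trans N≤n (ℕₚ.n≤1+n n))))) ⟩
      mesh n * (ε * ι (suc n))       ≡⟨ solve 3 (λ a b c → a :* (b :* c) := b :* (c :* a)) refl (mesh n) ε (ι (suc n)) ⟩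
      ε * (ι (suc n) * mesh n)       ≡⟨ cong (ε *_) (*-recip (ι (suc n)) (ι-pos n)) ⟩
      ε * 1ℚ                         ≡⟨ ℚₚ.*-identityʳ ε ⟩
      ε                              ∎
    where open ℚₚ.≤-Reasoning

  zero-square : ∀ p → p ≡ 0ℚ → p * p ≡ 0ℚ
  zero-square p p≡0 = trans (cong (p *_) p≡0) (ℚₚ.*-zeroʳ p)

  gridSquare : ℚ → ℕ → ℚ
  gridSquare h r = (ι r * h) * (ι r * h)

  choose : {P : Set} → Dec P → ℕ → ℕ → ℕ
  choose (yes _) r s = r
  choose (no _) r s = s

  -- The largest r ≤ b with (r h)² ≤ t (or 0 if there is none).
  gridRoot : ℚ → ℚ → ℕ → ℕ
  gridRoot h t zero = zero
  gridRoot h t (suc b) = choose (gridSquare h (suc b) ℚₚ.≤? t) (suc b) (gridRoot h t b)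

  choose-lower : ∀ h t r s (c : Dec (gridSquare h r ≤ t)) →
    gridSquare h s ≤ t → gridSquare h (choose c r s) ≤ t
  choose-lower h t r s (yes p) _ = p
  choose-lower h t r s (no _) q = q

  gridRoot-lower : ∀ h t b → 0ℚ ≤ t → gridSquare h (gridRoot h t b) ≤ t
  gridRoot-lower h t zero t≥0 = subst (_≤ t) (sym (zero-square (ι 0 * h) (ℚₚ.*-zeroˡ h))) t≥0
  gridRoot-lower h t (suc b) t≥0 =
    choose-lower h t (suc b) (gridRoot h t b) (gridSquare h (suc b) ℚₚ.≤? t) (gridRoot-lower h t b t≥0)

  choose-upper : ∀ h t r s (c : Dec (gridSquare h r ≤ t)) →
    t < gridSquare h (suc r) → (t < gridSquare h r → t < gridSquare h (suc s)) →
    t < gridSquare h (suc (choose c r s))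
  choose-upper h t r s (yes _) t< _ = t<
  choose-upper h t r s (no r≰t) _ rec = rec (ℚₚ.≰⇒> r≰t)

  gridRoot-upper : ∀ h t b → t < gridSquare h (suc b) → t < gridSquare h (suc (gridRoot h t b))
  gridRoot-upper h t zero t< = t<
  gridRoot-upper h t (suc b) t< =
    choose-upper h t (suc b) (gridRoot h t b) (gridSquare h (suc b) ℚₚ.≤? t) t< (gridRoot-upper h t b)

  sqrtBound : ℕ → ℚ → ℕ
  sqrtBound n q = proj₁ (archimedean (((q ⊔ 0ℚ) + 1ℚ) * ι (suc n)))

  -- The largest multiple of 1/(n+1) whose square is at most max(q,0).
  sqrtApprox : ℕ → ℚ → ℚ
  sqrtApprox n q = ι (gridRoot (mesh n) (q ⊔ 0ℚ) (sqrtBound n q)) * mesh n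

  sqrtApprox-nonneg : ∀ n q → 0ℚ ≤ sqrtApprox n q
  sqrtApprox-nonneg n q = *-nonneg {ι (gridRoot (mesh n) (q ⊔ 0ℚ) (sqrtBound n q))} {mesh n}
    (ι-nonneg (gridRoot (mesh n) (q ⊔ 0ℚ) (sqrtBound n q))) (ℚₚ.<⇒≤ (mesh-pos n))

  sqrtApprox-lower : ∀ n q → sqrtApprox n q * sqrtApprox n q ≤ q ⊔ 0ℚ
  sqrtApprox-lower n q = gridRoot-lower (mesh n) (q ⊔ 0ℚ) (sqrtBound n q) (ℚₚ.p≤q⊔p q 0ℚ)

  sqrtApprox-upper : ∀ n q →
    q ⊔ 0ℚ < (sqrtApprox n q + mesh n) * (sqrtApprox n q + mesh n)
  sqrtApprox-upper n q = subst (λ s → t < s * s) step (gridRoot-upper h t B t<)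
    where
    open ℚₚ.≤-Reasoning
    t = q ⊔ 0ℚ
    h = mesh n
    B = sqrtBound n q
    r = gridRoot h t B
    step : ι (suc r) * h ≡ ι r * h + h
    step = trans (cong (_* h) (ι-suc r))
      (trans (ℚₚ.*-distribʳ-+ h 1ℚ (ι r))
      (trans (cong (_+ ι r * h) (ℚₚ.*-identityˡ h)) (ℚₚ.+-comm h (ι r * h))))
    t≥0 : 0ℚ ≤ t
    t≥0 = ℚₚ.p≤q⊔p q 0ℚ
    t+1≥0 : 0ℚ ≤ t + 1ℚ
    t+1≥0 = ℚₚ.≤-trans t≥0 (≤-+-nonneg t (ℚₚ.<⇒≤ 1>0))
    t+1≤ : t + 1ℚ ≤ ι (suc B) * h
    t+1≤ = begin
      t + 1ℚ                          ≡⟨ sym (ℚₚ.*-identityʳ (t + 1ℚ)) ⟩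
      (t + 1ℚ) * 1ℚ                   ≡⟨ cong ((t + 1ℚ) *_) (sym (*-recip (ι (suc n)) (ι-pos n))) ⟩
      (t + 1ℚ) * (ι (suc n) * h)      ≡⟨ sym (ℚₚ.*-assoc (t + 1ℚ) (ι (suc n)) h) ⟩
      (t + 1ℚ) * ι (suc n) * h        ≤⟨ ℚₚ.*-monoʳ-≤-nonNeg h {{nonNegative (ℚₚ.<⇒≤ (mesh-pos n))}}
                                           (ℚₚ.≤-trans (proj₂ (archimedean ((t + 1ℚ) * ι (suc n)))) (ι-step B)) ⟩
      ι (suc B) * h                   ∎
    t< : t < (ι (suc B) * h) * (ι (suc B) * h)
    t< = begin-strict
      t                                    <⟨ <-+-pos t 1>0 ⟩
      t + 1ℚ                               ≡⟨ sym (ℚₚ.*-identityʳ (t + 1ℚ)) ⟩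
      (t + 1ℚ) * 1ℚ                        ≤⟨ ℚₚ.*-monoˡ-≤-nonNeg (t + 1ℚ) {{nonNegative t+1≥0}}
                                                (subst (1ℚ ≤_) (ℚₚ.+-comm 1ℚ t) (≤-+-nonneg 1ℚ t≥0)) ⟩
      (t + 1ℚ) * (t + 1ℚ)                  ≤⟨ *-mono t+1≥0 (ℚₚ.≤-trans t+1≥0 t+1≤) t+1≤ t+1≤ ⟩
      (ι (suc B) * h) * (ι (suc B) * h)    ∎

  sqrtApprox-close : ∀ m n p q {e} → 0ℚ ≤ e → ∣ p - q ∣ℚ ≤ e * e →
    sqrtApprox m p ≤ (sqrtApprox n q + mesh n) + e
  sqrtApprox-close m n p q {e} e≥0 d≤ = square-cancel-≤ (ℚₚ.≤-trans u≥0 (≤-+-nonneg u e≥0)) (begin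
    sqrtApprox m p * sqrtApprox m p    ≤⟨ sqrtApprox-lower m p ⟩
    p ⊔ 0ℚ                             ≤⟨ dist⇒≤+ (p ⊔ 0ℚ) (q ⊔ 0ℚ) (dist-⊔ p 0ℚ q 0ℚ d≤ (dist-refl 0ℚ e²≥0)) ⟩
    (q ⊔ 0ℚ) + e * e                   ≤⟨ ℚₚ.+-monoˡ-≤ (e * e) (ℚₚ.<⇒≤ (sqrtApprox-upper n q)) ⟩
    u * u + e * e                      ≤⟨ ≤-+-nonneg (u * u + e * e) (*-nonneg (ℚₚ.<⇒≤ (ℚₚ.<-trans 1>0 (<-+-pos 1ℚ 1>0))) (*-nonneg u≥0 e≥0)) ⟩
    u * u + e * e + (1ℚ + 1ℚ) * (u * e) ≡⟨ solve 2 (λ u e → u :* u :+ e :* e :+ (con 1ℚ :+ con 1ℚ) :* (u :* e) := (u :+ e) :* (u :+ e)) refl u e ⟩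
    (u + e) * (u + e)                  ∎)
    where
    open ℚₚ.≤-Reasoning
    u = sqrtApprox n q + mesh n
    u≥0 : 0ℚ ≤ u
    u≥0 = ℚₚ.≤-trans (sqrtApprox-nonneg n q) (≤-+-nonneg (sqrtApprox n q) (ℚₚ.<⇒≤ (mesh-pos n)))
    e²≥0 = *-nonneg e≥0 e≥0

open RationalFacts

-- Reals are Cauchy sequences of rationals; _≃_ is equality of reals.
record ℝ : Set where
  no-eta-equality
  field
    seq    : ℕ → ℚ
    cauchy : ∀ ε → 0ℚ ℚ.< ε →
             ∃[ N ] ∀ m n → N ℕ.≤ m → N ℕ.≤ n → ℚ.∣ seq m ℚ.- seq n ∣ ℚ.≤ ε

open ℝ public

infix 4 _≃_ _≤_

record _≃_ (x y : ℝ) : Set where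
  no-eta-equality
  constructor mk≃
  field
    un≃ : ∀ ε → 0ℚ ℚ.< ε → ∃[ N ] ∀ n → N ℕ.≤ n → ℚ.∣ seq x n ℚ.- seq y n ∣ ℚ.≤ ε

record _≤_ (x y : ℝ) : Set where
  no-eta-equality
  constructor mk≤
  field
    un≤ : ∀ ε → 0ℚ ℚ.< ε → ∃[ N ] ∀ n → N ℕ.≤ n → seq x n ℚ.≤ seq y n ℚ.+ ε

open _≃_ public
open _≤_ public

infixl 6 _+_ _-_ _⊔_
infixl 7 _*_
infix  8 -_

boundˡ : ∀ {M N k} → M ℕ.⊔ N ℕ.≤ k → M ℕ.≤ k
boundˡ {M} {N} = ℕₚ.≤-trans (ℕₚ.m≤m⊔n M N)

boundʳ : ∀ {M N k} → M ℕ.⊔ N ℕ.≤ k → N ℕ.≤ k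
boundʳ {M} {N} = ℕₚ.≤-trans (ℕₚ.m≤n⊔m M N)

bounded : ∀ x → ∃[ K ] 0ℚ ℚ.< K × (∃[ N ] ∀ n → N ℕ.≤ n → ℚ.∣ seq x n ∣ ℚ.≤ K)
bounded x with cauchy x 1ℚ 1>0
... | N , h = ℚ.∣ a ∣ ℚ.+ 1ℚ
            , ℚₚ.≤-<-trans (ℚₚ.0≤∣p∣ a) (<-+-pos ℚ.∣ a ∣ 1>0)
            , N , λ n N≤n → subst (λ z → ℚ.∣ z ∣ ℚ.≤ ℚ.∣ a ∣ ℚ.+ 1ℚ)
                (+-*-Solver.solve 2 (λ a b → a +-*-Solver.:+ (b +-*-Solver.:- a) +-*-Solver.:= b) refl a (seq x n))
                (ℚₚ.≤-trans (ℚₚ.∣p+q∣≤∣p∣+∣q∣ a (seq x n ℚ.- a))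
                  (ℚₚ.+-monoʳ-≤ ℚ.∣ a ∣ (h n N N≤n ℕₚ.≤-refl)))
  where a = seq x N

-- For K, L > 0 and ε > 0, a positive e with (K + L) e = ε.
split : ∀ K L ε → 0ℚ ℚ.< K → 0ℚ ℚ.< L → 0ℚ ℚ.< ε →
        ∃[ e ] 0ℚ ℚ.< e × (K ℚ.+ L) ℚ.* e ≡ ε
split K L ε K>0 L>0 ε>0 =
    recip (K ℚ.+ L) K+L>0 ℚ.* ε
  , *-pos (recip-pos (K ℚ.+ L) K+L>0) ε>0
  , trans (sym (ℚₚ.*-assoc (K ℚ.+ L) (recip (K ℚ.+ L) K+L>0) ε))
      (trans (cong (ℚ._* ε) (*-recip (K ℚ.+ L) K+L>0)) (ℚₚ.*-identityˡ ε))
  where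
  K+L>0 : 0ℚ ℚ.< K ℚ.+ L
  K+L>0 = ℚₚ.<-trans K>0 (<-+-pos K L>0)

fromℚ : ℚ → ℝ
seq (fromℚ q) _ = q
cauchy (fromℚ q) ε ε>0 = 0 , λ _ _ _ _ → dist-refl q (ℚₚ.<⇒≤ ε>0)

fromℕ : ℕ → ℝ
fromℕ n = fromℚ (ℤ.+ n ℚ./ 1)

0ℝ 1ℝ : ℝ
0ℝ = fromℚ 0ℚ
1ℝ = fromℚ 1ℚ

_+_ : ℝ → ℝ → ℝ
seq (x + y) n = seq x n ℚ.+ seq y n
cauchy (x + y) ε ε>0 =
  let M , h = cauchy x (½ ℚ.* ε) (half-pos ε>0)
      N , k = cauchy y (½ ℚ.* ε) (half-pos ε>0)
  in M ℕ.⊔ N , λ m n ≤m ≤n → subst (ℚ.∣ (seq x m ℚ.+ seq y m) ℚ.- (seq x n ℚ.+ seq y n) ∣ ℚ.≤_) (half+half ε)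
       (dist-+ (seq x m) (seq y m) (seq x n) (seq y n)
         (h m n (boundˡ {M} {N} ≤m) (boundˡ {M} {N} ≤n)) (k m n (boundʳ {M} {N} ≤m) (boundʳ {M} {N} ≤n)))

-_ : ℝ → ℝ
seq (- x) n = ℚ.- seq x n
cauchy (- x) ε ε>0 =
  let N , h = cauchy x ε ε>0
  in N , λ m n ≤m ≤n → dist-neg (seq x m) (seq x n) (h m n ≤m ≤n)

_-_ : ℝ → ℝ → ℝ
x - y = x + - y

_*_ : ℝ → ℝ → ℝ
seq (x * y) n = seq x n ℚ.* seq y n
cauchy (x * y) ε ε>0 =
  let K , K>0 , A , a = bounded x
      L , L>0 , B , b = bounded y
      e , e>0 , eq = split K L ε K>0 L>0 ε>0
      M , h = cauchy x e e>0
      N , k = cauchy y e e>0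
      R = (A ℕ.⊔ B) ℕ.⊔ (M ℕ.⊔ N)
      inA = λ i (p : R ℕ.≤ i) → boundˡ {A} {B} (boundˡ {A ℕ.⊔ B} {M ℕ.⊔ N} p)
      inB = λ i (p : R ℕ.≤ i) → boundʳ {A} {B} (boundˡ {A ℕ.⊔ B} {M ℕ.⊔ N} p)
      inM = λ i (p : R ℕ.≤ i) → boundˡ {M} {N} (boundʳ {A ℕ.⊔ B} {M ℕ.⊔ N} p)
      inN = λ i (p : R ℕ.≤ i) → boundʳ {M} {N} (boundʳ {A ℕ.⊔ B} {M ℕ.⊔ N} p)
  in R , λ m n ≤m ≤n → subst (ℚ.∣ (seq x m ℚ.* seq y m) ℚ.- (seq x n ℚ.* seq y n) ∣ ℚ.≤_) eq
       (dist-* (seq x m) (seq y m) (seq x n) (seq y n) (a m (inA m ≤m)) (b n (inB n ≤n)) (ℚₚ.<⇒≤ e>0)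
         (h m n (inM m ≤m) (inM n ≤n)) (k m n (inN m ≤m) (inN n ≤n)))

_⊔_ : ℝ → ℝ → ℝ
seq (x ⊔ y) n = seq x n ℚ.⊔ seq y n
cauchy (x ⊔ y) ε ε>0 =
  let M , h = cauchy x ε ε>0
      N , k = cauchy y ε ε>0
  in M ℕ.⊔ N , λ m n ≤m ≤n → dist-⊔ (seq x m) (seq y m) (seq x n) (seq y n)
       (h m n (boundˡ {M} {N} ≤m) (boundˡ {M} {N} ≤n)) (k m n (boundʳ {M} {N} ≤m) (boundʳ {M} {N} ≤n))

-- The square root of max(x,0).
√ : ℝ → ℝ
seq (√ x) n = sqrtApprox n (seq x n)
cauchy (√ x) ε ε>0 =
  let e = ½ ℚ.* ε
      e>0 = half-pos ε>0
      M , h = cauchy x (e ℚ.* e) (*-pos e>0 e>0)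
      N , k = mesh-small e e>0
      close : ∀ m n → M ℕ.⊔ N ℕ.≤ m → M ℕ.⊔ N ℕ.≤ n →
              sqrtApprox m (seq x m) ℚ.≤ sqrtApprox n (seq x n) ℚ.+ ε
      close m n ≤m ≤n = ℚₚ.≤-trans
        (sqrtApprox-close m n (seq x m) (seq x n) (ℚₚ.<⇒≤ e>0) (h m n (boundˡ {M} {N} ≤m) (boundˡ {M} {N} ≤n)))
        (subst (sqrtApprox n (seq x n) ℚ.+ mesh n ℚ.+ e ℚ.≤_)
          (trans (ℚₚ.+-assoc (sqrtApprox n (seq x n)) e e) (cong (λ z → sqrtApprox n (seq x n) ℚ.+ z) (half+half ε)))
          (ℚₚ.+-monoˡ-≤ e (ℚₚ.+-monoʳ-≤ (sqrtApprox n (seq x n)) (k n (boundʳ {M} {N} ≤n)))))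
  in M ℕ.⊔ N , λ m n ≤m ≤n →
       ≤+⇒dist (sqrtApprox m (seq x m)) (sqrtApprox n (seq x n)) (close m n ≤m ≤n) (close n m ≤n ≤m)

pointwise : ∀ {x y} → (∀ n → seq x n ≡ seq y n) → x ≃ y
pointwise {x} {y} eq = mk≃ λ ε ε>0 → 0 , λ n _ →
  subst (λ z → ℚ.∣ seq x n ℚ.- z ∣ ℚ.≤ ε) (eq n) (dist-refl (seq x n) (ℚₚ.<⇒≤ ε>0))

≃-isEquivalence : IsEquivalence _≃_
≃-isEquivalence = record
  { refl  = pointwise (λ _ → refl)
  ; sym   = λ {x} {y} h → mk≃ λ ε ε>0 → let N , k = un≃ h ε ε>0 in
      N , λ n N≤n → subst (ℚ._≤ ε) (∣-∣-comm (seq x n) (seq y n)) (k n N≤n)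
  ; trans = λ {x} {y} {z} h k → mk≃ λ ε ε>0 →
      let M , h′ = un≃ h (½ ℚ.* ε) (half-pos ε>0)
          N , k′ = un≃ k (½ ℚ.* ε) (half-pos ε>0)
      in M ℕ.⊔ N , λ n ≤n → subst (ℚ.∣ seq x n ℚ.- seq z n ∣ ℚ.≤_) (half+half ε)
           (dist-trans (seq x n) (seq y n) (seq z n) (h′ n (boundˡ {M} {N} ≤n)) (k′ n (boundʳ {M} {N} ≤n)))
  }

+-cong : ∀ {x y u v} → x ≃ y → u ≃ v → x + u ≃ y + v
+-cong {x} {y} {u} {v} h k = mk≃ λ ε ε>0 →
  let M , h′ = un≃ h (½ ℚ.* ε) (half-pos ε>0)
      N , k′ = un≃ k (½ ℚ.* ε) (half-pos ε>0)
  in M ℕ.⊔ N , λ n ≤n → subst (ℚ.∣ (seq x n ℚ.+ seq u n) ℚ.- (seq y n ℚ.+ seq v n) ∣ ℚ.≤_) (half+half ε)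
       (dist-+ (seq x n) (seq u n) (seq y n) (seq v n) (h′ n (boundˡ {M} {N} ≤n)) (k′ n (boundʳ {M} {N} ≤n)))

*-cong : ∀ {x y u v} → x ≃ y → u ≃ v → x * u ≃ y * v
*-cong {x} {y} {u} {v} h k = mk≃ λ ε ε>0 →
  let K , K>0 , A , a = bounded x
      L , L>0 , B , b = bounded v
      e , e>0 , eq = split K L ε K>0 L>0 ε>0
      M , h′ = un≃ h e e>0
      N , k′ = un≃ k e e>0
  in (A ℕ.⊔ B) ℕ.⊔ (M ℕ.⊔ N) , λ n ≤n →
       let ≤AB = boundˡ {A ℕ.⊔ B} {M ℕ.⊔ N} ≤n
           ≤MN = boundʳ {A ℕ.⊔ B} {M ℕ.⊔ N} ≤n
       in subst (ℚ.∣ (seq x n ℚ.* seq u n) ℚ.- (seq y n ℚ.* seq v n) ∣ ℚ.≤_) eq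
            (dist-* (seq x n) (seq u n) (seq y n) (seq v n)
              (a n (boundˡ {A} {B} ≤AB)) (b n (boundʳ {A} {B} ≤AB)) (ℚₚ.<⇒≤ e>0)
              (h′ n (boundˡ {M} {N} ≤MN)) (k′ n (boundʳ {M} {N} ≤MN)))

-‿cong : ∀ {x y} → x ≃ y → - x ≃ - y
-‿cong {x} {y} h = mk≃ λ ε ε>0 →
  let N , k = un≃ h ε ε>0 in N , λ n N≤n → dist-neg (seq x n) (seq y n) (k n N≤n)

+-*-isCommutativeRing : IsCommutativeRing _≃_ _+_ _*_ -_ 0ℝ 1ℝ
+-*-isCommutativeRing = record
  { isRing = record
    { +-isAbelianGroup = record
      { isGroup = record
        { isMonoid = record
          { isSemigroup = record
            { isMagma = record
              { isEquivalence = ≃-isEquivalence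
              ; ∙-cong = +-cong }
            ; assoc = λ x y z → pointwise λ n → ℚₚ.+-assoc (seq x n) (seq y n) (seq z n) }
          ; identity = (λ x → pointwise λ n → ℚₚ.+-identityˡ (seq x n))
                     , (λ x → pointwise λ n → ℚₚ.+-identityʳ (seq x n)) }
        ; inverse = (λ x → pointwise λ n → ℚₚ.+-inverseˡ (seq x n))
                  , (λ x → pointwise λ n → ℚₚ.+-inverseʳ (seq x n))
        ; ⁻¹-cong = -‿cong }
      ; comm = λ x y → pointwise λ n → ℚₚ.+-comm (seq x n) (seq y n) }
    ; *-cong = *-cong
    ; *-assoc = λ x y z → pointwise λ n → ℚₚ.*-assoc (seq x n) (seq y n) (seq z n)
    ; *-identity = (λ x → pointwise λ n → ℚₚ.*-identityˡ (seq x n))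
                 , (λ x → pointwise λ n → ℚₚ.*-identityʳ (seq x n))
    ; distrib = (λ x y z → pointwise λ n → ℚₚ.*-distribˡ-+ (seq x n) (seq y n) (seq z n))
              , (λ x y z → pointwise λ n → ℚₚ.*-distribʳ-+ (seq x n) (seq y n) (seq z n)) }
  ; *-comm = λ x y → pointwise λ n → ℚₚ.*-comm (seq x n) (seq y n)
  }

ℝ-commutativeRing : CommutativeRing 0ℓ 0ℓ
ℝ-commutativeRing = record { isCommutativeRing = +-*-isCommutativeRing }

√-nonneg : ∀ x → 0ℝ ≤ √ x
√-nonneg x = mk≤ λ ε ε>0 → 0 , λ n _ → ℚₚ.≤-trans (sqrtApprox-nonneg n (seq x n))
  (≤-+-nonneg (sqrtApprox n (seq x n)) (ℚₚ.<⇒≤ ε>0))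

√-square : ∀ x → 0ℝ ≤ x → √ x * √ x ≃ x
√-square x x≥0 = mk≃ λ ε ε>0 →
  let K , K>0 , A , a = bounded (√ x)
      e , e>0 , eq = split (K ℚ.+ K) 1ℚ (½ ℚ.* ε) (ℚₚ.<-trans K>0 (<-+-pos K K>0)) 1>0 (half-pos ε>0)
      B , small = mesh-small e e>0
      C , tiny = mesh-small 1ℚ 1>0
      D , pos = un≤ x≥0 ε ε>0
  in (A ℕ.⊔ B) ℕ.⊔ (C ℕ.⊔ D) , λ n ≤n →
     let ≤AB = boundˡ {A ℕ.⊔ B} {C ℕ.⊔ D} ≤n
         ≤CD = boundʳ {A ℕ.⊔ B} {C ℕ.⊔ D} ≤n
     in estimate ε ε>0 n K e eq (ℚₚ.<⇒≤ e>0)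
          (ℚₚ.≤-trans (p≤∣p∣ (seq (√ x) n)) (a n (boundˡ {A} {B} ≤AB)))
          (small n (boundʳ {A} {B} ≤AB)) (tiny n (boundˡ {C} {D} ≤CD)) (pos n (boundʳ {C} {D} ≤CD))
  where
  estimate : ∀ ε → 0ℚ ℚ.< ε → ∀ n K e → ((K ℚ.+ K) ℚ.+ 1ℚ) ℚ.* e ≡ ½ ℚ.* ε → 0ℚ ℚ.≤ e →
    seq (√ x) n ℚ.≤ K → mesh n ℚ.≤ e → mesh n ℚ.≤ 1ℚ → 0ℚ ℚ.≤ seq x n ℚ.+ ε →
    ℚ.∣ seq (√ x) n ℚ.* seq (√ x) n ℚ.- seq x n ∣ ℚ.≤ ε
  estimate ε ε>0 n K e eq e≥0 s≤K h≤e h≤1 0≤q+ε = ≤+⇒dist (s ℚ.* s) q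
    (ℚₚ.≤-trans (sqrtApprox-lower n q)
      (ℚₚ.⊔-lub (≤-+-nonneg q (ℚₚ.<⇒≤ ε>0)) 0≤q+ε))
    (begin
      q                                             ≤⟨ ℚₚ.p≤p⊔q q 0ℚ ⟩
      q ℚ.⊔ 0ℚ                                      ≤⟨ ℚₚ.<⇒≤ (sqrtApprox-upper n q) ⟩
      (s ℚ.+ h) ℚ.* (s ℚ.+ h)                       ≡⟨ solve 2 (λ s h → (s :+ h) :* (s :+ h) := s :* s :+ ((s :+ s) :+ h) :* h) refl s h ⟩
      s ℚ.* s ℚ.+ ((s ℚ.+ s) ℚ.+ h) ℚ.* h           ≤⟨ ℚₚ.+-monoʳ-≤ (s ℚ.* s)
                                                         (*-mono {(s ℚ.+ s) ℚ.+ h} {(K ℚ.+ K) ℚ.+ 1ℚ} {h} {e} ssh≥0 e≥0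
                                                           (ℚₚ.+-mono-≤ (ℚₚ.+-mono-≤ s≤K s≤K) h≤1) h≤e) ⟩
      s ℚ.* s ℚ.+ ((K ℚ.+ K) ℚ.+ 1ℚ) ℚ.* e          ≡⟨ cong (λ z → s ℚ.* s ℚ.+ z) eq ⟩
      s ℚ.* s ℚ.+ ½ ℚ.* ε                           ≤⟨ ℚₚ.+-monoʳ-≤ (s ℚ.* s) (subst (½ ℚ.* ε ℚ.≤_) (half+half ε) (≤-+-nonneg (½ ℚ.* ε) (ℚₚ.<⇒≤ (half-pos ε>0)))) ⟩
      s ℚ.* s ℚ.+ ε                                 ∎)
    where
    open ℚₚ.≤-Reasoning
    open +-*-Solver
    q = seq x n
    s = sqrtApprox n q
    h = mesh n
    s≥0 = sqrtApprox-nonneg n q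
    ssh≥0 : 0ℚ ℚ.≤ (s ℚ.+ s) ℚ.+ h
    ssh≥0 = ℚₚ.≤-trans (ℚₚ.≤-trans s≥0 (≤-+-nonneg s s≥0)) (≤-+-nonneg (s ℚ.+ s) (ℚₚ.<⇒≤ (mesh-pos n)))

module ℝ-ring = CommutativeRing ℝ-commutativeRing

open Algebra.Properties.Semiring.Sum ℝ-ring.semiring public

ℝ^_ : ℕ → Set
ℝ^ d = Vector ℝ d

Matrix : ℕ → ℕ → Set
Matrix n d = Vector (ℝ^ d) n

-- The submatrix formed by the rows indexed by S, in increasing order.
_↾_ : ∀ {n d} → Matrix n d → (S : Subset n) → Matrix ∣ S ∣ d
(A ↾ (inside ∷ S)) zero    = A zero
(A ↾ (inside ∷ S)) (suc i) = ((A ∘ suc) ↾ S) i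
(A ↾ (outside ∷ S)) i      = ((A ∘ suc) ↾ S) i

infix 4 _≋_

_≋_ : ∀ {d} → ℝ^ d → ℝ^ d → Set
v ≋ w = ∀ j → v j ≃ w j

_·_ : ∀ {d} → ℝ^ d → ℝ^ d → ℝ
_·_ {d} v w = ∑[ j < d ] (v j * w j)

‖_‖ : ∀ {d} → ℝ^ d → ℝ
‖ v ‖ = √ (v · v)

linComb : ∀ {m d} → ℝ^ m → Vector (ℝ^ d) m → ℝ^ d
linComb {m} c w j = ∑[ i < m ] (c i * w i j)

record Subspace (d : ℕ) : Set₁ where
  field
    member         : ℝ^ d → Set
    member-resp    : ∀ {v w} → v ≋ w → member v → member w
    0-closed       : member (λ _ → 0ℝ)
    +-closed       : ∀ {v w} → member v → member w → member (λ j → v j + w j)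
    scaling-closed : ∀ c {v} → member v → member (λ j → c * v j)

open Subspace public

infix 4 _∈ˢ_

_∈ˢ_ : ∀ {d} → ℝ^ d → Subspace d → Set
v ∈ˢ V = member V v

span : ∀ {m d} → Vector (ℝ^ d) m → Subspace d
span {m} {d} w = record
  { member = λ v → ∃[ c ] v ≋ linComb c w
  ; member-resp = λ v≋v′ (c , eq) → c , λ j → ℝ-ring.trans (ℝ-ring.sym (v≋v′ j)) (eq j)
  ; 0-closed = (λ _ → 0ℝ) , λ j → ℝ-ring.sym (ℝ-ring.trans
      (sum-cong-≋ (λ i → ℝ-ring.zeroˡ (w i j))) (sum-replicate-zero m))
  ; +-closed = λ (b , eq) (c , eq′) → (λ i → b i + c i) , λ j → ℝ-ring.trans
      (+-cong (eq j) (eq′ j))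
      (ℝ-ring.trans (ℝ-ring.sym (∑-distrib-+ (λ i → b i * w i j) (λ i → c i * w i j)))
        (sum-cong-≋ (λ i → ℝ-ring.sym (ℝ-ring.distribʳ (w i j) (b i) (c i)))))
  ; scaling-closed = λ a (c , eq) → (λ i → a * c i) , λ j → ℝ-ring.trans
      (*-cong (ℝ-ring.refl {a}) (eq j))
      (ℝ-ring.trans (*-distribˡ-sum a (λ i → c i * w i j))
        (sum-cong-≋ (λ i → ℝ-ring.sym (ℝ-ring.*-assoc a (c i) (w i j)))))
  }

LinearlyIndependent : ∀ {m d} → Vector (ℝ^ d) m → Set
LinearlyIndependent w = ∀ c → linComb c w ≋ (λ _ → 0ℝ) → ∀ i → c i ≃ 0ℝ

IsBasis : ∀ {m d} → Vector (ℝ^ d) m → Subspace d → Set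
IsBasis w V = (∀ i → w i ∈ˢ V) × LinearlyIndependent w × (∀ v → v ∈ˢ V → v ∈ˢ span w)

_HasDim_ : ∀ {d} → Subspace d → ℕ → Set
_HasDim_ {d} V k = Σ (Vector (ℝ^ d) k) λ w → IsBasis w V

IsMinimum : ∀ {ℓ} → (ℝ → Set ℓ) → ℝ → Set ℓ
IsMinimum P r = P r × (∀ s → P s → r ≤ s)

-- d(a, V) = r.  Minima of sets of reals are relations here, since a
-- minimum need not be constructible.
IsDistance : ∀ {d} → ℝ^ d → Subspace d → ℝ → Set
IsDistance a V = IsMinimum λ s → ∃[ v ] v ∈ˢ V × s ≃ ‖ (λ j → a j - v j) ‖

-- The maximum of f over S for nonnegative f: starting the fold from 0
-- only matters when S is empty, where the maximum is 0 by convention.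
maxOver : ∀ {n} → Subset n → Vector ℝ n → ℝ
maxOver []            f = 0ℝ
maxOver (inside ∷ S)  f = f zero ⊔ maxOver S (f ∘ suc)
maxOver (outside ∷ S) f = maxOver S (f ∘ suc)

-- max_{i ∈ T} d(aᵢ, V) = r
IsMaxDistance : ∀ {n d} → Matrix n d → Subset n → Subspace d → ℝ → Set
IsMaxDistance {n} A T V r =
  Σ (Vector ℝ n) λ δ → (∀ i → i ∈ T → IsDistance (A i) V (δ i)) × r ≃ maxOver T δ

-- The objective values of the rank-k ℓ∞ subspace approximation problem on A.
Objective : ∀ {n d} → Matrix n d → ℕ → ℝ → Set₁
Objective {d = d} A k r = Σ (Subspace d) λ V → V HasDim k × IsMaxDistance A ⊤ V r

-- Compares with every objective value, not only a minimal one, so it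
-- does not presuppose that the minimum over k-dimensional subspaces is
-- attained.
record IsApproximateSolution {n d} (c : ℝ) (A : Matrix n d) (k : ℕ) (V : Subspace d) : Set₁ where
  field
    dimension    : V HasDim k
    near-optimal : ∀ x y → IsMaxDistance A ⊤ V x → Objective A k y → x ≤ c * y

δ[_,_] : ℕ → ℕ → ℝ
δ[ i , j ] = if i ℕ.≡ᵇ j then 1ℝ else 0ℝ

Orthonormal : ∀ {m d} → Vector (ℝ^ d) m → Set
Orthonormal w = ∀ i j → w i · w j ≃ δ[ toℕ i , toℕ j ]

-- A full SVD  B = U Σ Wᵀ  with U (m × m) and W (d × d) orthogonal and Σ
-- (m × d) rectangular diagonal.  `leftVector p` and `rightVector q` are
-- the columns of U and W.  σ has one entry for every right singular
-- vector, the missing ones (when m < d) being 0.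
record FullSVD {m d} (B : Matrix m d) : Set where
  field
    leftVector        : Vector (ℝ^ m) m
    rightVector       : Vector (ℝ^ d) d
    σ                 : ℝ^ d
    left-orthonormal  : Orthonormal leftVector
    right-orthonormal : Orthonormal rightVector
    σ-nonneg          : ∀ q → 0ℝ ≤ σ q
    σ-decreasing      : ∀ p q → p Fin.≤ q → σ q ≤ σ p
    σ-missing         : ∀ q → m ℕ.≤ toℕ q → σ q ≃ 0ℝ
    decomposition     : ∀ i j → B i j ≃
      ∑[ p < m ] ∑[ q < d ] (leftVector p i * (δ[ toℕ p , toℕ q ] * σ q) * rightVector q j)

topRightSingularSubspace : ∀ {m d k} {B : Matrix m d} → FullSVD B → k ℕ.≤ d → Subspace d
topRightSingularSubspace {k = k} svd k≤d = span {k} λ j → FullSVD.rightVector svd (inject≤ j k≤d)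

{-# OPTIONS --safe #-}

-- The coreset property at Ṽ reduces the claim to max_{i∈S} d(aᵢ, Ṽ) ≤ √|S| max_{i∈S} d(aᵢ, V).
-- The left side is at most the square root of Σ_{i∈S} d(aᵢ, Ṽ)², which Ṽ minimises among
-- k-dimensional subspaces (Eckart–Young), and Σ_{i∈S} d(aᵢ, V)² ≤ |S| max_{i∈S} d(aᵢ, V)².
-- For at most k orthonormal vectors u_l whose span contains V, Eckart–Young becomes Ky Fan's
-- inequality Σ_l ‖A_S u_l‖² = Σ_q σ_q² Σ_l ⟨r_q, u_l⟩² ≤ Σ_{q<k} σ_q², where Bessel bounds the
-- inner sums by 1 and their total by k.  Only Bessel is needed, never completeness of the r_q.
-- Constructively, u exists only up to double negation, which is harmless because ≤ on ℝ is stable.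

module Submission where

import Algebra.Properties.CommutativeSemigroup
open import Data.Bool using (true; false)
open import Data.Fin using (Fin; zero; suc; toℕ; inject≤)
import Data.Fin as Fin
import Data.Fin.Properties as Finₚ
open import Data.Fin.Subset using (Subset; inside; outside; ∣_∣; _∈_; ⊤)
open import Data.Fin.Subset.Properties using (∈⊤)
open import Data.Nat as ℕ using (ℕ; zero; suc)
import Data.Nat.Properties as ℕₚ
open import Data.Product using (∃-syntax; _×_; _,_; proj₁; proj₂)
open import Data.Rational as ℚ using (ℚ; 0ℚ; 1ℚ; ½; nonNegative) hiding (module ℚ)
import Data.Rational.Properties as ℚₚ
open import Data.Rational.Solver using (module +-*-Solver)
open import Data.Sum using (inj₁; inj₂)
open import Data.Vec using ([]; _∷_; here; there)
open import Data.Vec.Functional as VF using (Vector)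
open import Function using (_∘_)
open import Level using (0ℓ)
open import Relation.Binary.Bundles using (Poset)
open import Relation.Binary.PropositionalEquality as ≡ using (_≡_)
import Relation.Binary.Reasoning.PartialOrder
open import Relation.Nullary using (¬_; yes; no; contradiction)
open import Defs
open RationalFacts
open +-*-Solver
open Algebra.Properties.CommutativeSemigroup ℝ-ring.+-commutativeSemigroup
  using () renaming (interchange to +-interchange)
open Algebra.Properties.CommutativeSemigroup ℝ-ring.*-commutativeSemigroup
  using () renaming (interchange to *-interchange; x∙yz≈y∙xz to x*yz≃y*xz)

-- The ordered field of reals

≃-refl : ∀ {x} → x ≃ x
≃-refl = ℝ-ring.refl

≃-reflexive : ∀ {x y} → x ≡ y → x ≃ y
≃-reflexive ≡.refl = ≃-refl

≃-sym : ∀ {x y} → x ≃ y → y ≃ x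
≃-sym = ℝ-ring.sym

≃-trans : ∀ {x y z} → x ≃ y → y ≃ z → x ≃ z
≃-trans = ℝ-ring.trans

≤-pointwise : ∀ {x y} → (∀ n → seq x n ℚ.≤ seq y n) → x ≤ y
≤-pointwise {x} {y} h = mk≤ λ ε ε>0 → 0 , λ n _ →
  ℚₚ.≤-trans (h n) (≤-+-nonneg (seq y n) (ℚₚ.<⇒≤ ε>0))

≤-reflexive : ∀ {x y} → x ≃ y → x ≤ y
≤-reflexive {x} {y} h = mk≤ λ ε ε>0 → let N , k = un≃ h ε ε>0 in
  N , λ n N≤n → dist⇒≤+ (seq x n) (seq y n) (k n N≤n)

≤-refl : ∀ {x} → x ≤ x
≤-refl = ≤-reflexive ≃-refl

≤-trans : ∀ {x y z} → x ≤ y → y ≤ z → x ≤ z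
≤-trans {x} {y} {z} h k = mk≤ λ ε ε>0 →
  let M , h′ = un≤ h (½ ℚ.* ε) (half-pos ε>0)
      N , k′ = un≤ k (½ ℚ.* ε) (half-pos ε>0)
  in M ℕ.⊔ N , λ n ≤n → ≡.subst (seq x n ℚ.≤_)
       (≡.trans (ℚₚ.+-assoc (seq z n) (½ ℚ.* ε) (½ ℚ.* ε)) (≡.cong (seq z n ℚ.+_) (half+half ε)))
       (ℚₚ.≤-trans (h′ n (boundˡ {M} {N} ≤n)) (ℚₚ.+-monoˡ-≤ (½ ℚ.* ε) (k′ n (boundʳ {M} {N} ≤n))))

≤-antisym : ∀ {x y} → x ≤ y → y ≤ x → x ≃ y
≤-antisym {x} {y} h k = mk≃ λ ε ε>0 →
  let M , h′ = un≤ h ε ε>0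
      N , k′ = un≤ k ε ε>0
  in M ℕ.⊔ N , λ n ≤n → ≤+⇒dist (seq x n) (seq y n) (h′ n (boundˡ {M} {N} ≤n)) (k′ n (boundʳ {M} {N} ≤n))

≤-poset : Poset 0ℓ 0ℓ 0ℓ
≤-poset = record
  { isPartialOrder = record
    { isPreorder = record
      { isEquivalence = ≃-isEquivalence
      ; reflexive = ≤-reflexive
      ; trans = ≤-trans }
    ; antisym = ≤-antisym } }

module ≤-Reasoning = Relation.Binary.Reasoning.PartialOrder ≤-poset

+-mono-≤ : ∀ {x y u v} → x ≤ y → u ≤ v → x + u ≤ y + v
+-mono-≤ {x} {y} {u} {v} h k = mk≤ λ ε ε>0 →
  let M , h′ = un≤ h (½ ℚ.* ε) (half-pos ε>0)
      N , k′ = un≤ k (½ ℚ.* ε) (half-pos ε>0)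
  in M ℕ.⊔ N , λ n ≤n → ≡.subst (seq x n ℚ.+ seq u n ℚ.≤_)
       (≡.trans
         (solve 3 (λ a b e → (a :+ e) :+ (b :+ e) := (a :+ b) :+ (e :+ e)) ≡.refl (seq y n) (seq v n) (½ ℚ.* ε))
         (≡.cong (seq y n ℚ.+ seq v n ℚ.+_) (half+half ε)))
       (ℚₚ.+-mono-≤ (h′ n (boundˡ {M} {N} ≤n)) (k′ n (boundʳ {M} {N} ≤n)))

≤-+ : ∀ {x y} → 0ℝ ≤ y → x ≤ x + y
≤-+ {x} {y} y≥0 = begin
  x         ≈⟨ ℝ-ring.+-identityʳ x ⟨
  x + 0ℝ    ≤⟨ +-mono-≤ (≤-refl {x}) y≥0 ⟩
  x + y     ∎
  where open ≤-Reasoning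

+-nonneg : ∀ {x y} → 0ℝ ≤ x → 0ℝ ≤ y → 0ℝ ≤ x + y
+-nonneg x≥0 y≥0 = ≤-trans x≥0 (≤-+ y≥0)

+-cancelʳ-≤ : ∀ {x y} z → x + z ≤ y + z → x ≤ y
+-cancelʳ-≤ {x} {y} z h = begin
  x              ≈⟨ undo x ⟨
  x + z + - z    ≤⟨ +-mono-≤ h (≤-refl { - z}) ⟩
  y + z + - z    ≈⟨ undo y ⟩
  y              ∎
  where
  open ≤-Reasoning
  undo : ∀ w → w + z + - z ≃ w
  undo w = pointwise λ n → solve 2 (λ w z → w :+ z :+ (:- z) := w) ≡.refl (seq w n) (seq z n)

≤⇒0≤- : ∀ {x y} → x ≤ y → 0ℝ ≤ y - x
≤⇒0≤- {x} {y} x≤y = begin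
  0ℝ       ≈⟨ ℝ-ring.-‿inverseʳ x ⟨
  x - x    ≤⟨ +-mono-≤ x≤y (≤-refl { - x}) ⟩
  y - x    ∎
  where open ≤-Reasoning

square-nonneg : ∀ x → 0ℝ ≤ x * x
square-nonneg x = ≤-pointwise λ n → nonneg (seq x n)
  where
  nonneg : ∀ q → 0ℚ ℚ.≤ q ℚ.* q
  nonneg q = ≡.subst (0ℚ ℚ.≤_) ∣q∣² (*-nonneg (ℚₚ.0≤∣p∣ q) (ℚₚ.0≤∣p∣ q))
    where
    ∣q∣² : ∣ q ∣ℚ ℚ.* ∣ q ∣ℚ ≡ q ℚ.* q
    ∣q∣² with ℚₚ.∣p∣≡p∨∣p∣≡-p q
    ... | inj₁ eq = ≡.cong₂ ℚ._*_ eq eq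
    ... | inj₂ eq = ≡.trans (≡.cong₂ ℚ._*_ eq eq)
      (solve 1 (λ q → (:- q) :* (:- q) := q :* q) ≡.refl q)

-- The product is the square of `√ x * √ y`, which reduces the claim to `square-nonneg`.
*-nonneg-ℝ : ∀ {x y} → 0ℝ ≤ x → 0ℝ ≤ y → 0ℝ ≤ x * y
*-nonneg-ℝ {x} {y} x≥0 y≥0 = begin
  0ℝ                               ≤⟨ square-nonneg (√ x * √ y) ⟩
  (√ x * √ y) * (√ x * √ y)        ≈⟨ *-interchange (√ x) (√ y) (√ x) (√ y) ⟩
  (√ x * √ x) * (√ y * √ y)        ≈⟨ *-cong (√-square x x≥0) (√-square y y≥0) ⟩
  x * y                            ∎
  where open ≤-Reasoning

*-monoˡ-≤ : ∀ {x y z} → 0ℝ ≤ z → x ≤ y → z * x ≤ z * y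
*-monoˡ-≤ {x} {y} {z} z≥0 x≤y = begin
  z * x                  ≤⟨ ≤-+ (*-nonneg-ℝ z≥0 (≤⇒0≤- x≤y)) ⟩
  z * x + z * (y - x)    ≈⟨ pointwise (λ n → solve 3 (λ x y z → z :* x :+ z :* (y :+ (:- x)) := z :* y) ≡.refl (seq x n) (seq y n) (seq z n)) ⟩
  z * y                  ∎
  where open ≤-Reasoning

square-mono : ∀ {x y} → 0ℝ ≤ x → x ≤ y → x * x ≤ y * y
square-mono {x} {y} x≥0 x≤y = begin
  x * x    ≤⟨ *-monoˡ-≤ x≥0 x≤y ⟩
  x * y    ≈⟨ ℝ-ring.*-comm x y ⟩
  y * x    ≤⟨ *-monoˡ-≤ (≤-trans x≥0 x≤y) x≤y ⟩
  y * y    ∎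
  where open ≤-Reasoning

square-cancel-≤-ℝ : ∀ {x y} → 0ℝ ≤ y → x * x ≤ y * y → x ≤ y
square-cancel-≤-ℝ {x} {y} y≥0 x²≤y² = mk≤ λ ε ε>0 →
  -- Here e = ε/4: the estimate loses 3e, and one spare e completes ε.
  let e = ½ ℚ.* (½ ℚ.* ε)
      e>0 = half-pos (half-pos ε>0)
      M , h = un≤ y≥0 e e>0
      N , k = un≤ x²≤y² (e ℚ.* e) (*-pos e>0 e>0)
  in M ℕ.⊔ N , λ n ≤n → ℚₚ.≤-trans
       (estimate (seq x n) (seq y n) e (ℚₚ.<⇒≤ e>0) (h n (boundˡ {M} {N} ≤n)) (k n (boundʳ {M} {N} ≤n)))
       (≡.subst (λ z → seq y n ℚ.+ (e ℚ.+ e ℚ.+ e) ℚ.≤ seq y n ℚ.+ z) (4e ε)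
         (ℚₚ.+-monoʳ-≤ (seq y n) (≤-+-nonneg (e ℚ.+ e ℚ.+ e) (ℚₚ.<⇒≤ e>0))))
  where
  4e : ∀ ε → (½ ℚ.* (½ ℚ.* ε) ℚ.+ ½ ℚ.* (½ ℚ.* ε) ℚ.+ ½ ℚ.* (½ ℚ.* ε)) ℚ.+ ½ ℚ.* (½ ℚ.* ε) ≡ ε
  4e ε = solve 1 (λ ε → let e = con ½ :* (con ½ :* ε) in (e :+ e :+ e) :+ e := ε) ≡.refl ε
  estimate : ∀ p q e → 0ℚ ℚ.≤ e → 0ℚ ℚ.≤ q ℚ.+ e → p ℚ.* p ℚ.≤ q ℚ.* q ℚ.+ e ℚ.* e →
    p ℚ.≤ q ℚ.+ (e ℚ.+ e ℚ.+ e)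
  estimate p q e e≥0 q+e≥0 p²≤ = square-cancel-≤ u≥0 (begin
    p ℚ.* p                                      ≤⟨ p²≤ ⟩
    -- The added term 2e(3(q + e) + e) is what q² + e² lacks to be (q + 3e)². Since q itself may be
    -- slightly negative, it is grouped around q + e ≥ 0.
    q ℚ.* q ℚ.+ e ℚ.* e                          ≤⟨ ≤-+-nonneg _ (*-nonneg (ℚₚ.≤-trans e≥0 (≤-+-nonneg e e≥0)) (ℚₚ.+-mono-≤ q+e≥0 (ℚₚ.+-mono-≤ q+e≥0 (ℚₚ.+-mono-≤ q+e≥0 e≥0)))) ⟩
    q ℚ.* q ℚ.+ e ℚ.* e ℚ.+ (e ℚ.+ e) ℚ.* ((q ℚ.+ e) ℚ.+ ((q ℚ.+ e) ℚ.+ ((q ℚ.+ e) ℚ.+ e)))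
      ≡⟨ solve 2 (λ q e → q :* q :+ e :* e :+ (e :+ e) :* ((q :+ e) :+ ((q :+ e) :+ ((q :+ e) :+ e))) := (q :+ (e :+ e :+ e)) :* (q :+ (e :+ e :+ e))) ≡.refl q e ⟩
    (q ℚ.+ (e ℚ.+ e ℚ.+ e)) ℚ.* (q ℚ.+ (e ℚ.+ e ℚ.+ e)) ∎)
    where
    open ℚₚ.≤-Reasoning
    u≥0 : 0ℚ ℚ.≤ q ℚ.+ (e ℚ.+ e ℚ.+ e)
    u≥0 = ≡.subst (0ℚ ℚ.≤_) (solve 2 (λ q e → (q :+ e) :+ (e :+ e) := q :+ (e :+ e :+ e)) ≡.refl q e)
      (ℚₚ.+-mono-≤ q+e≥0 (ℚₚ.+-mono-≤ e≥0 e≥0))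

square-zero : ∀ {x} → x * x ≤ 0ℝ → x ≃ 0ℝ
square-zero {x} x²≤0 = ≤-antisym (≤0 x x²≤0) (begin
  0ℝ            ≤⟨ ≤⇒0≤- (≤0 (- x) -x²≤0) ⟩
  0ℝ - - x      ≈⟨ pointwise (λ n → solve 1 (λ x → con 0ℚ :+ (:- (:- x)) := x) ≡.refl (seq x n)) ⟩
  x             ∎)
  where
  open ≤-Reasoning
  ≤0 : ∀ y → y * y ≤ 0ℝ → y ≤ 0ℝ
  ≤0 y y²≤0 = square-cancel-≤-ℝ ≤-refl (≤-trans y²≤0 (≤-reflexive (≃-sym (ℝ-ring.zeroˡ 0ℝ))))
  -x²≤0 : - x * - x ≤ 0ℝ
  -x²≤0 = ≤-trans (≤-reflexive (pointwise λ n → solve 1 (λ x → (:- x) :* (:- x) := x :* x) ≡.refl (seq x n))) x²≤0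

⊔-lub : ∀ {x y z} → x ≤ z → y ≤ z → x ⊔ y ≤ z
⊔-lub h k = mk≤ λ ε ε>0 →
  let M , h′ = un≤ h ε ε>0
      N , k′ = un≤ k ε ε>0
  in M ℕ.⊔ N , λ n ≤n → ℚₚ.⊔-lub (h′ n (boundˡ {M} {N} ≤n)) (k′ n (boundʳ {M} {N} ≤n))

x≤x⊔y : ∀ x y → x ≤ x ⊔ y
x≤x⊔y x y = ≤-pointwise λ n → ℚₚ.p≤p⊔q (seq x n) (seq y n)

y≤x⊔y : ∀ x y → y ≤ x ⊔ y
y≤x⊔y x y = ≤-pointwise λ n → ℚₚ.p≤q⊔p (seq x n) (seq y n)

-- The rational lower bound is data: constructively it is more than the failure of `x ≤ 0ℝ`, and it
-- is what allows `x` to be inverted.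
Positive : ℝ → Set
Positive x = ∃[ c ] 0ℚ ℚ.< c × fromℚ c ≤ x

-- Past an index N where the sequence oscillates by at most ε/2, one decidable rational comparison
-- settles the matter. Either the N-th entry is at most ε/2, so all later ones are at most ε, or its
-- excess over ε/2 is a rational lower bound of `x`.
¬Positive⇒≤0 : ∀ {x} → ¬ Positive x → x ≤ 0ℝ
¬Positive⇒≤0 {x} ¬pos = mk≤ bound
  where
  bound : ∀ ε → 0ℚ ℚ.< ε → ∃[ N ] ∀ n → N ℕ.≤ n → seq x n ℚ.≤ 0ℚ ℚ.+ ε
  bound ε ε>0 with cauchy x (½ ℚ.* ε) (half-pos ε>0)
  ... | N , osc with seq x N ℚₚ.≤? ½ ℚ.* ε
  ... | yes small = N , λ n N≤n → ≡.subst (seq x n ℚ.≤_)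
          (≡.trans (half+half ε) (≡.sym (ℚₚ.+-identityˡ ε)))
          (ℚₚ.≤-trans (dist⇒≤+ (seq x n) (seq x N) (osc n N N≤n ℕₚ.≤-refl)) (ℚₚ.+-monoˡ-≤ (½ ℚ.* ε) small))
  ... | no large = contradiction (gap , gap>0 , gap≤x) ¬pos
    where
    e = ½ ℚ.* ε
    gap = seq x N ℚ.- e
    gap>0 : 0ℚ ℚ.< gap
    gap>0 = ≡.subst (ℚ._< gap) (ℚₚ.+-inverseʳ e) (ℚₚ.+-monoˡ-< (ℚ.- e) (ℚₚ.≰⇒> large))
    gap≤x : fromℚ gap ≤ x
    gap≤x = mk≤ λ η η>0 → N , λ n N≤n → ℚₚ.≤-trans
      (≤+⇒diff≤ (seq x N) e (≡.subst (seq x N ℚ.≤_) (ℚₚ.+-comm (seq x n) e)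
        (dist⇒≤+ (seq x N) (seq x n) (osc N n ℕₚ.≤-refl N≤n))))
      (≤-+-nonneg (seq x n) (ℚₚ.<⇒≤ η>0))

¬Positive-0 : ¬ Positive 0ℝ
¬Positive-0 (c , c>0 , c≤0) with un≤ c≤0 (½ ℚ.* c) (half-pos c>0)
... | N , h = ℚₚ.<-irrefl ≡.refl (ℚₚ.<-≤-trans c/2<c c≤c/2)
  where
  c≤c/2 : c ℚ.≤ ½ ℚ.* c
  c≤c/2 = ≡.subst (c ℚ.≤_) (ℚₚ.+-identityˡ (½ ℚ.* c)) (h N ℕₚ.≤-refl)
  c/2<c : ½ ℚ.* c ℚ.< c
  c/2<c = ≡.subst (½ ℚ.* c ℚ.<_) (half+half c) (<-+-pos (½ ℚ.* c) (half-pos c>0))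

-- A positive `x - y` would refute `x ≤ y`, so the double negation excludes it. This lets an
-- inequality be derived from objects that exist only up to double negation.
≤-stable : ∀ {x y} → ¬ ¬ (x ≤ y) → x ≤ y
≤-stable {x} {y} ¬¬x≤y = +-cancelʳ-≤ (- y) (≤-trans (¬Positive⇒≤0 ¬pos) (≤-reflexive (≃-sym (ℝ-ring.-‿inverseʳ y))))
  where
  ¬pos : ¬ Positive (x - y)
  ¬pos (c , c>0 , c≤) = ¬¬x≤y λ x≤y → ¬Positive-0 (c , c>0 ,
    ≤-trans c≤ (≤-trans (+-mono-≤ x≤y (≤-refl { - y})) (≤-reflexive (ℝ-ring.-‿inverseʳ y))))

reciprocal : ∀ {x} → Positive x → ∃[ y ] x * y ≃ 1ℝ
reciprocal {x} (c , c>0 , c≤x) = y , xy≃1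
  where
  h = ½ ℚ.* c
  h>0 = half-pos c>0
  -- Truncating the sequence below at h > 0 leaves x unchanged and makes every term invertible.
  t : ℕ → ℚ
  t n = seq x n ℚ.⊔ h
  t>0 : ∀ n → 0ℚ ℚ.< t n
  t>0 n = ℚₚ.<-≤-trans h>0 (ℚₚ.p≤q⊔p (seq x n) h)
  r : ℕ → ℚ
  r n = recip (t n) (t>0 n)
  R = recip h h>0
  r≤R : ∀ n → r n ℚ.≤ R
  r≤R n = begin
    r n                        ≡⟨ ℚₚ.*-identityʳ (r n) ⟨
    r n ℚ.* 1ℚ                 ≡⟨ ≡.cong (r n ℚ.*_) (*-recip h h>0) ⟨
    r n ℚ.* (h ℚ.* R)          ≤⟨ ℚₚ.*-monoˡ-≤-nonNeg (r n) {{nonNegative (ℚₚ.<⇒≤ (recip-pos (t n) (t>0 n)))}}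
                                    (ℚₚ.*-monoʳ-≤-nonNeg R {{nonNegative (ℚₚ.<⇒≤ (recip-pos h h>0))}} (ℚₚ.p≤q⊔p (seq x n) h)) ⟩
    r n ℚ.* (t n ℚ.* R)        ≡⟨ solve 3 (λ a b c → a :* (b :* c) := (b :* a) :* c) ≡.refl (r n) (t n) R ⟩
    (t n ℚ.* r n) ℚ.* R        ≡⟨ ≡.cong (ℚ._* R) (*-recip (t n) (t>0 n)) ⟩
    1ℚ ℚ.* R                   ≡⟨ ℚₚ.*-identityˡ R ⟩
    R                          ∎
    where open ℚₚ.≤-Reasoning
  -- This is 1/a - 1/b = (b - a)/(ab), for the positive terms a and b of `t`.
  r-dist : ∀ m n → ∣ r m ℚ.- r n ∣ℚ ≡ ∣ t n ℚ.- t m ∣ℚ ℚ.* (r m ℚ.* r n)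
  r-dist m n = begin
    ∣ r m ℚ.- r n ∣ℚ
      ≡⟨ ≡.cong₂ (λ a b → ∣ a ℚ.- b ∣ℚ) (ℚₚ.*-identityʳ (r m)) (ℚₚ.*-identityʳ (r n)) ⟨
    ∣ r m ℚ.* 1ℚ ℚ.- r n ℚ.* 1ℚ ∣ℚ
      ≡⟨ ≡.cong₂ (λ a b → ∣ r m ℚ.* a ℚ.- r n ℚ.* b ∣ℚ) (*-recip (t n) (t>0 n)) (*-recip (t m) (t>0 m)) ⟨
    ∣ r m ℚ.* (t n ℚ.* r n) ℚ.- r n ℚ.* (t m ℚ.* r m) ∣ℚ
      ≡⟨ ≡.cong ∣_∣ℚ (solve 4 (λ rm rn tm tn → rm :* (tn :* rn) :- rn :* (tm :* rm) := (tn :- tm) :* (rm :* rn)) ≡.refl (r m) (r n) (t m) (t n)) ⟩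
    ∣ (t n ℚ.- t m) ℚ.* (r m ℚ.* r n) ∣ℚ
      ≡⟨ ℚₚ.∣p*q∣≡∣p∣*∣q∣ (t n ℚ.- t m) (r m ℚ.* r n) ⟩
    ∣ t n ℚ.- t m ∣ℚ ℚ.* ∣ r m ℚ.* r n ∣ℚ
      ≡⟨ ≡.cong (∣ t n ℚ.- t m ∣ℚ ℚ.*_) (ℚₚ.0≤p⇒∣p∣≡p (*-nonneg (ℚₚ.<⇒≤ (recip-pos (t m) (t>0 m))) (ℚₚ.<⇒≤ (recip-pos (t n) (t>0 n))))) ⟩
    ∣ t n ℚ.- t m ∣ℚ ℚ.* (r m ℚ.* r n) ∎
    where open ≡.≡-Reasoning
  y : ℝ
  seq y = r
  cauchy y ε ε>0 =
    -- Both reciprocals are at most R = 1/h, so their distance is at most R² times that of the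
    -- terms; the factor h² cancels R².
    let e = ε ℚ.* (h ℚ.* h)
        N , osc = cauchy x e (*-pos ε>0 (*-pos h>0 h>0))
    in N , λ m n N≤m N≤n → begin
      ∣ r m ℚ.- r n ∣ℚ                           ≡⟨ r-dist m n ⟩
      ∣ t n ℚ.- t m ∣ℚ ℚ.* (r m ℚ.* r n)         ≤⟨ *-mono {∣ t n ℚ.- t m ∣ℚ} {e} {r m ℚ.* r n} {R ℚ.* R}
                                                      (ℚₚ.0≤∣p∣ (t n ℚ.- t m)) (*-nonneg R≥0 R≥0)
                                                      (dist-⊔ (seq x n) h (seq x m) h (osc n m N≤n N≤m) (dist-refl h (ℚₚ.<⇒≤ (*-pos ε>0 (*-pos h>0 h>0)))))
                                                      (*-mono {r m} {R} {r n} {R} (ℚₚ.<⇒≤ (recip-pos (t m) (t>0 m))) R≥0 (r≤R m) (r≤R n)) ⟩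
      e ℚ.* (R ℚ.* R)                            ≡⟨ solve 3 (λ ε h R → (ε :* (h :* h)) :* (R :* R) := ε :* ((h :* R) :* (h :* R))) ≡.refl ε h R ⟩
      ε ℚ.* ((h ℚ.* R) ℚ.* (h ℚ.* R))            ≡⟨ ≡.cong (λ z → ε ℚ.* (z ℚ.* z)) (*-recip h h>0) ⟩
      ε ℚ.* 1ℚ                                   ≡⟨ ℚₚ.*-identityʳ ε ⟩
      ε                                          ∎
    where
    open ℚₚ.≤-Reasoning
    R≥0 : 0ℚ ℚ.≤ R
    R≥0 = ℚₚ.<⇒≤ (recip-pos h h>0)
  xy≃1 : x * y ≃ 1ℝ
  -- From c ≤ x and h = c/2 the entries of `x` are eventually at least h. There the truncation
  -- changes nothing and the product is exactly 1.
  xy≃1 = mk≃ λ ε ε>0 → let N , k = un≤ c≤x h h>0 in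
    N , λ n N≤n → ≡.subst (λ z → ∣ z ℚ.- 1ℚ ∣ℚ ℚ.≤ ε)
      (≡.sym (≡.trans
        (≡.cong (ℚ._* r n) (≡.sym (ℚₚ.p≥q⇒p⊔q≡p (h≤ {seq x n} (k n N≤n)))))
        (*-recip (t n) (t>0 n))))
      (dist-refl 1ℚ (ℚₚ.<⇒≤ ε>0))
    where
    h≤ : ∀ {q} → c ℚ.≤ q ℚ.+ h → h ℚ.≤ q
    h≤ {q} c≤ = ≡.subst₂ ℚ._≤_
      (≡.trans (≡.cong (ℚ._- h) (≡.sym (half+half c))) (cancel h h)) (cancel q h) (ℚₚ.+-monoˡ-≤ (ℚ.- h) c≤)
      where
      cancel : ∀ a b → (a ℚ.+ b) ℚ.- b ≡ a
      cancel = solve 2 (λ a b → (a :+ b) :- b := a) ≡.refl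

-- Sums and inner products

sum-mono : ∀ {n} {f g : Vector ℝ n} → (∀ i → f i ≤ g i) → sum f ≤ sum g
sum-mono {zero}  h = ≤-refl
sum-mono {suc n} h = +-mono-≤ (h zero) (sum-mono (h ∘ suc))

sum-nonneg : ∀ {n} {f : Vector ℝ n} → (∀ i → 0ℝ ≤ f i) → 0ℝ ≤ sum f
sum-nonneg {zero}  h = ≤-refl
sum-nonneg {suc n} h = +-nonneg (h zero) (sum-nonneg (h ∘ suc))

term≤sum : ∀ {n} {f : Vector ℝ n} → (∀ i → 0ℝ ≤ f i) → ∀ i → f i ≤ sum f
term≤sum {f = f} h zero = ≤-+ (sum-nonneg (h ∘ suc))
term≤sum {f = f} h (suc i) = begin
  f (suc i)                 ≤⟨ term≤sum (h ∘ suc) i ⟩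
  sum (f ∘ suc)             ≤⟨ ≤-+ (h zero) ⟩
  sum (f ∘ suc) + f zero    ≈⟨ ℝ-ring.+-comm (sum (f ∘ suc)) (f zero) ⟩
  sum f                     ∎
  where open ≤-Reasoning

sum-ones-mono : ∀ {m n} → m ℕ.≤ n → ∑[ i < m ] 1ℝ ≤ ∑[ i < n ] 1ℝ
sum-ones-mono {n = n} ℕ.z≤n = sum-nonneg {n} λ _ → ≤-pointwise λ _ → ℚₚ.<⇒≤ 1>0
sum-ones-mono (ℕ.s≤s m≤n) = +-mono-≤ (≤-refl {1ℝ}) (sum-ones-mono m≤n)

sum-ones : ∀ n → ∑[ i < n ] 1ℝ ≃ fromℕ n
sum-ones zero    = ≃-refl
sum-ones (suc n) = begin-equality
  1ℝ + ∑[ i < n ] 1ℝ    ≈⟨ +-cong (≃-refl {1ℝ}) (sum-ones n) ⟩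
  1ℝ + fromℕ n          ≈⟨ pointwise (λ _ → ι-suc n) ⟨
  fromℕ (suc n)         ∎
  where open ≤-Reasoning

sum-δ : ∀ {n} (f : Vector ℝ n) i → ∑[ j < n ] (δ[ toℕ i , toℕ j ] * f j) ≃ f i
sum-δ {suc n} f zero = begin-equality
  1ℝ * f zero + ∑[ j < n ] (0ℝ * f (suc j))
    ≈⟨ +-cong (ℝ-ring.*-identityˡ (f zero)) (sum-cong-≋ (λ j → ℝ-ring.zeroˡ (f (suc j)))) ⟩
  f zero + ∑[ j < n ] 0ℝ    ≈⟨ +-cong (≃-refl {f zero}) (sum-replicate-zero n) ⟩
  f zero + 0ℝ               ≈⟨ ℝ-ring.+-identityʳ (f zero) ⟩
  f zero                    ∎
  where open ≤-Reasoning
sum-δ {suc n} f (suc i) = begin-equality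
  0ℝ * f zero + ∑[ j < n ] (δ[ toℕ i , toℕ j ] * f (suc j))
    ≈⟨ +-cong (ℝ-ring.zeroˡ (f zero)) (sum-δ (f ∘ suc) i) ⟩
  0ℝ + f (suc i)    ≈⟨ ℝ-ring.+-identityˡ (f (suc i)) ⟩
  f (suc i)         ∎
  where open ≤-Reasoning

δ-idem : ∀ i j → δ[ i , j ] * δ[ i , j ] ≃ δ[ i , j ]
δ-idem i j with i ℕ.≡ᵇ j
... | true  = ℝ-ring.*-identityˡ 1ℝ
... | false = ℝ-ring.zeroˡ 0ℝ

δ-diag : ∀ i → δ[ i , i ] ≃ 1ℝ
δ-diag zero    = ≃-refl
δ-diag (suc i) = δ-diag i

·-cong : ∀ {d} {v v′ w w′ : ℝ^ d} → v ≋ v′ → w ≋ w′ → v · w ≃ v′ · w′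
·-cong h k = sum-cong-≋ λ j → *-cong (h j) (k j)

·-comm : ∀ {d} (v w : ℝ^ d) → v · w ≃ w · v
·-comm v w = sum-cong-≋ λ j → ℝ-ring.*-comm (v j) (w j)

·-nonneg : ∀ {d} (v : ℝ^ d) → 0ℝ ≤ v · v
·-nonneg v = sum-nonneg λ j → square-nonneg (v j)

infixl 6 _⊖_

_⊖_ : ∀ {d} → ℝ^ d → ℝ^ d → ℝ^ d
(v ⊖ w) j = v j - w j

·-⊖ : ∀ {d} (x v w : ℝ^ d) → x · (v ⊖ w) ≃ x · v - x · w
·-⊖ {zero}  x v w = pointwise λ _ → ≡.refl
·-⊖ {suc d} x v w = ≃-trans (+-cong (≃-refl {x zero * (v zero - w zero)}) (·-⊖ (x ∘ suc) (v ∘ suc) (w ∘ suc)))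
  (pointwise λ n → solve 5 (λ x v w p q → x :* (v :+ (:- w)) :+ (p :+ (:- q)) := (x :* v :+ p) :+ (:- (x :* w :+ q)))
    ≡.refl (seq (x zero) n) (seq (v zero) n) (seq (w zero) n)
      (seq ((x ∘ suc) · (v ∘ suc)) n) (seq ((x ∘ suc) · (w ∘ suc)) n))

square-⊖ : ∀ {d} (v w : ℝ^ d) → (v ⊖ w) · (v ⊖ w) + (v · w + v · w) ≃ v · v + w · w
square-⊖ v w = begin-equality
  (v ⊖ w) · (v ⊖ w) + (v · w + v · w)
    ≈⟨ +-cong expand (≃-refl {v · w + v · w}) ⟩
  ((v · v - v · w) - (v · w - w · w)) + (v · w + v · w)
    ≈⟨ pointwise (λ n → solve 3 (λ vv vw ww → ((vv :+ (:- vw)) :+ (:- (vw :+ (:- ww)))) :+ (vw :+ vw) := vv :+ ww)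
         ≡.refl (seq (v · v) n) (seq (v · w) n) (seq (w · w) n)) ⟩
  v · v + w · w ∎
  where
  open ≤-Reasoning
  left : ∀ x → (v ⊖ w) · x ≃ v · x - w · x
  left x = begin-equality
    (v ⊖ w) · x      ≈⟨ ·-comm (v ⊖ w) x ⟩
    x · (v ⊖ w)      ≈⟨ ·-⊖ x v w ⟩
    x · v - x · w    ≈⟨ +-cong (·-comm x v) (-‿cong (·-comm x w)) ⟩
    v · x - w · x    ∎
  expand : (v ⊖ w) · (v ⊖ w) ≃ (v · v - v · w) - (v · w - w · w)
  expand = begin-equality
    (v ⊖ w) · (v ⊖ w)                    ≈⟨ ·-⊖ (v ⊖ w) v w ⟩
    (v ⊖ w) · v - (v ⊖ w) · w            ≈⟨ +-cong (left v) (-‿cong (left w)) ⟩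
    (v · v - w · v) - (v · w - w · w)    ≈⟨ +-cong (+-cong (≃-refl {v · v}) (-‿cong (·-comm w v))) (≃-refl { - (v · w - w · w)}) ⟩
    (v · v - v · w) - (v · w - w · w)    ∎

·-zeroʳ : ∀ {d} (v : ℝ^ d) → v · (λ _ → 0ℝ) ≃ 0ℝ
·-zeroʳ {d} v = ≃-trans (sum-cong-≋ λ j → ℝ-ring.zeroʳ (v j)) (sum-replicate-zero d)

·-linComb : ∀ {m d} (a : ℝ^ d) (c : ℝ^ m) (w : Vector (ℝ^ d) m) →
  a · linComb c w ≃ c · (λ l → a · w l)
·-linComb {m} {d} a c w = begin-equality
  ∑[ j < d ] (a j * ∑[ l < m ] (c l * w l j))      ≈⟨ sum-cong-≋ (λ j → *-distribˡ-sum (a j) (λ l → c l * w l j)) ⟩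
  ∑[ j < d ] ∑[ l < m ] (a j * (c l * w l j))      ≈⟨ ∑-comm (λ j l → a j * (c l * w l j)) ⟩
  ∑[ l < m ] ∑[ j < d ] (a j * (c l * w l j))      ≈⟨ sum-cong-≋ (λ l → sum-cong-≋ (λ j → x*yz≃y*xz (a j) (c l) (w l j))) ⟩
  ∑[ l < m ] ∑[ j < d ] (c l * (a j * w l j))      ≈⟨ sum-cong-≋ (λ l → *-distribˡ-sum (c l) (λ j → a j * w l j)) ⟨
  ∑[ l < m ] (c l * ∑[ j < d ] (a j * w l j))      ∎
  where
  open ≤-Reasoning

generator∈span : ∀ {m d} (w : Vector (ℝ^ d) m) i → w i ∈ˢ span w
generator∈span w i = (λ l → δ[ toℕ i , toℕ l ]) , λ j → ≃-sym (sum-δ (λ l → w l j) i)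

span⊆ : ∀ {m d} (w : Vector (ℝ^ d) m) (V : Subspace d) → (∀ i → w i ∈ˢ V) → ∀ {v} → v ∈ˢ span w → v ∈ˢ V
span⊆ w V w∈V (c , v≋) = member-resp V (λ j → ≃-sym (v≋ j)) (linComb∈ c w w∈V)
  where
  linComb∈ : ∀ {m} (c : ℝ^ m) w → (∀ i → w i ∈ˢ V) → linComb c w ∈ˢ V
  linComb∈ {zero}  c w w∈V = 0-closed V
  linComb∈ {suc m} c w w∈V = +-closed V (scaling-closed V (c zero) (w∈V zero)) (linComb∈ (c ∘ suc) (w ∘ suc) (w∈V ∘ suc))

-- Orthonormal families

-- For an orthonormal `u` these are the coefficients of the orthogonal projection of `a`. Applied to
-- a matrix, seen as the family of its rows, the same formula is the matrix-vector product.
coords : ∀ {m d} → Vector (ℝ^ d) m → ℝ^ d → ℝ^ m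
coords u a l = a · u l

module _ {m d} (u : Vector (ℝ^ d) m) (on : Orthonormal u) where
  open ≤-Reasoning

  coords-linComb : ∀ c → coords u (linComb c u) ≋ c
  coords-linComb c i = begin-equality
    linComb c u · u i                           ≈⟨ ·-comm (linComb c u) (u i) ⟩
    u i · linComb c u                           ≈⟨ ·-linComb (u i) c u ⟩
    ∑[ l < m ] (c l * (u i · u l))              ≈⟨ sum-cong-≋ (λ l → ≃-trans (ℝ-ring.*-comm (c l) (u i · u l)) (*-cong (on i l) (≃-refl {c l}))) ⟩
    ∑[ l < m ] (δ[ toℕ i , toℕ l ] * c l)       ≈⟨ sum-δ c i ⟩
    c i                                         ∎

  linComb-isometry : ∀ c → linComb c u · linComb c u ≃ c · c
  linComb-isometry c = ≃-trans (·-linComb (linComb c u) c u) (·-cong (λ _ → ≃-refl) (coords-linComb c))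

  orthonormal⇒independent : LinearlyIndependent u
  orthonormal⇒independent c c≋0 i = begin-equality
    c i                   ≈⟨ coords-linComb c i ⟨
    linComb c u · u i     ≈⟨ ·-comm (linComb c u) (u i) ⟩
    u i · linComb c u     ≈⟨ ·-cong (λ _ → ≃-refl) c≋0 ⟩
    u i · (λ _ → 0ℝ)      ≈⟨ ·-zeroʳ (u i) ⟩
    0ℝ                    ∎

  -- Completing the square: the distance from a to a combination with
  -- coefficients c is least when c = coords u a.
  pythagoras : ∀ a c → let g = coords u a ; v = linComb c u in
    (a ⊖ v) · (a ⊖ v) + g · g ≃ a · a + (c ⊖ g) · (c ⊖ g)
  pythagoras a c = begin-equality
    p + gg
      ≈⟨ pointwise (λ n → solve 3 (λ p gg cg → p :+ gg := (p :+ (cg :+ cg)) :+ (gg :+ (:- (cg :+ cg)))) ≡.refl (seq p n) (seq gg n) (seq cg n)) ⟩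
    (p + (cg + cg)) + (gg - (cg + cg))
      ≈⟨ +-cong expand (≃-refl {gg - (cg + cg)}) ⟩
    (aa + cc) + (gg - (cg + cg))
      ≈⟨ pointwise (λ n → solve 4 (λ aa cc gg cg → (aa :+ cc) :+ (gg :+ (:- (cg :+ cg))) := aa :+ ((cc :+ gg) :+ (:- (cg :+ cg)))) ≡.refl (seq aa n) (seq cc n) (seq gg n) (seq cg n)) ⟩
    aa + ((cc + gg) - (cg + cg))
      ≈⟨ +-cong (≃-refl {aa}) (+-cong (square-⊖ c g) (≃-refl { - (cg + cg)})) ⟨
    aa + ((q + (cg + cg)) - (cg + cg))
      ≈⟨ pointwise (λ n → solve 3 (λ aa q cg → aa :+ ((q :+ (cg :+ cg)) :+ (:- (cg :+ cg))) := aa :+ q) ≡.refl (seq aa n) (seq q n) (seq cg n)) ⟩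
    aa + q ∎
    where
    v = linComb c u
    g = coords u a
    p = (a ⊖ v) · (a ⊖ v)
    q = (c ⊖ g) · (c ⊖ g)
    aa = a · a
    cc = c · c
    cg = c · g
    gg = g · g
    expand : p + (cg + cg) ≃ aa + cc
    expand = begin-equality
      p + (cg + cg)          ≈⟨ +-cong (≃-refl {p}) (+-cong (·-linComb a c u) (·-linComb a c u)) ⟨
      p + (a · v + a · v)    ≈⟨ square-⊖ a v ⟩
      aa + v · v             ≈⟨ +-cong (≃-refl {aa}) (linComb-isometry c) ⟩
      aa + cc                ∎

  projection : ∀ a → let g = coords u a ; p = linComb g u in (a ⊖ p) · (a ⊖ p) + g · g ≃ a · a
  projection a = begin-equality
    _                            ≈⟨ pythagoras a g ⟩
    a · a + (g ⊖ g) · (g ⊖ g)    ≈⟨ +-cong (≃-refl {a · a}) (≃-trans (·-cong (λ _ → ≃-refl) (λ l → ℝ-ring.-‿inverseʳ (g l))) (·-zeroʳ (g ⊖ g))) ⟩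
    a · a + 0ℝ                   ≈⟨ ℝ-ring.+-identityʳ (a · a) ⟩
    a · a                        ∎
    where g = coords u a

  -- The squared norm splits into that of the projection and that of the residual, and the latter is
  -- dropped.
  bessel : ∀ a → coords u a · coords u a ≤ a · a
  bessel a = begin
    g · g                        ≤⟨ ≤-+ (·-nonneg (a ⊖ p)) ⟩
    g · g + (a ⊖ p) · (a ⊖ p)    ≈⟨ ℝ-ring.+-comm (g · g) ((a ⊖ p) · (a ⊖ p)) ⟩
    (a ⊖ p) · (a ⊖ p) + g · g    ≈⟨ projection a ⟩
    a · a                        ∎
    where
    g = coords u a
    p = linComb g u

  -- In `pythagoras` the square of `c ⊖ g` is the excess of `v` over the projection; it is
  -- nonnegative and dropped.
  projection-optimal : ∀ a {v} → v ∈ˢ span u → a · a ≤ (a ⊖ v) · (a ⊖ v) + coords u a · coords u a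
  projection-optimal a {v} (c , v≋) = begin
    a · a                            ≤⟨ ≤-+ (·-nonneg (c ⊖ g)) ⟩
    a · a + (c ⊖ g) · (c ⊖ g)        ≈⟨ pythagoras a c ⟨
    (a ⊖ linComb c u) · (a ⊖ linComb c u) + g · g
      ≈⟨ +-cong (·-cong a⊖v≋ a⊖v≋) (≃-refl {g · g}) ⟨
    (a ⊖ v) · (a ⊖ v) + g · g        ∎
    where
    g = coords u a
    a⊖v≋ : a ⊖ v ≋ a ⊖ linComb c u
    a⊖v≋ j = +-cong (≃-refl {a j}) (-‿cong (v≋ j))

-- Gram-Schmidt orthonormalisation

·-scaleʳ : ∀ {d} (v w : ℝ^ d) c → v · (λ j → c * w j) ≃ c * (v · w)
·-scaleʳ v w c = ≃-trans
  (sum-cong-≋ λ j → x*yz≃y*xz (v j) c (w j))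
  (≃-sym (*-distribˡ-sum c (λ j → v j * w j)))

-- The length `m` may fall below `k` because a vector whose residual vanishes contributes no new
-- direction.
OrthonormalHull : ∀ {k d} → Vector (ℝ^ d) k → Set
OrthonormalHull {k} {d} w =
  ∃[ m ] m ℕ.≤ k × ∃[ u ] Orthonormal {m} {d} u × (∀ i → w i ∈ˢ span u)

-- With ρ a squared norm, `s` is the norm and `e` its inverse. The inverse is formed as √ρ times
-- 1/ρ, since the positive lower bound is given for ρ and not for √ρ.
normaliser : ∀ {ρ} → 0ℝ ≤ ρ → Positive ρ → ∃[ s ] ∃[ e ] s * e ≃ 1ℝ × e * (e * ρ) ≃ 1ℝ
normaliser {ρ} ρ≥0 pos = let y , ρy≃1 = reciprocal pos in
  √ ρ , √ ρ * y , inverse y ρy≃1 , unit (√ ρ) y (inverse y ρy≃1) ρy≃1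
  where
  open ≤-Reasoning
  inverse : ∀ y → ρ * y ≃ 1ℝ → √ ρ * (√ ρ * y) ≃ 1ℝ
  inverse y ρy≃1 = begin-equality
    √ ρ * (√ ρ * y)    ≈⟨ ℝ-ring.*-assoc (√ ρ) (√ ρ) y ⟨
    √ ρ * √ ρ * y      ≈⟨ *-cong (√-square ρ ρ≥0) (≃-refl {y}) ⟩
    ρ * y              ≈⟨ ρy≃1 ⟩
    1ℝ                 ∎
  unit : ∀ s y → s * (s * y) ≃ 1ℝ → ρ * y ≃ 1ℝ → s * y * (s * y * ρ) ≃ 1ℝ
  unit s y inv ρy≃1 = begin-equality
    s * y * (s * y * ρ)      ≈⟨ *-interchange s y (s * y) ρ ⟩
    s * (s * y) * (y * ρ)    ≈⟨ *-cong inv (≃-trans (ℝ-ring.*-comm y ρ) ρy≃1) ⟩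
    1ℝ * 1ℝ                  ≈⟨ ℝ-ring.*-identityˡ 1ℝ ⟩
    1ℝ                       ∎

module _ {m d} (u : Vector (ℝ^ d) m) (on : Orthonormal u) (r : ℝ^ d) (s e : ℝ) where
  open ≤-Reasoning

  extend : Vector (ℝ^ d) (suc m)
  extend = (λ j → e * r j) VF.∷ u

  extend-orthonormal : e * (e * (r · r)) ≃ 1ℝ → (∀ l → u l · r ≃ 0ℝ) → Orthonormal extend
  extend-orthonormal unit r⊥u = on′
    where
    r₀ = λ j → e * r j
    orthogonal : ∀ l → u l · r₀ ≃ 0ℝ
    orthogonal l = begin-equality
      u l · r₀         ≈⟨ ·-scaleʳ (u l) r e ⟩
      e * (u l · r)    ≈⟨ *-cong (≃-refl {e}) (r⊥u l) ⟩
      e * 0ℝ           ≈⟨ ℝ-ring.zeroʳ e ⟩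
      0ℝ               ∎
    on′ : Orthonormal extend
    on′ zero    zero    = begin-equality
      r₀ · r₀            ≈⟨ ·-scaleʳ r₀ r e ⟩
      e * (r₀ · r)       ≈⟨ *-cong (≃-refl {e}) (≃-trans (·-comm r₀ r) (·-scaleʳ r r e)) ⟩
      e * (e * (r · r))  ≈⟨ unit ⟩
      1ℝ                 ∎
    on′ zero    (suc l) = ≃-trans (·-comm r₀ (u l)) (orthogonal l)
    on′ (suc l) zero    = orthogonal l
    on′ (suc i) (suc l) = on i l

  span⊆span-extend : ∀ {v} → v ∈ˢ span u → v ∈ˢ span extend
  span⊆span-extend = span⊆ u (span extend) (λ l → generator∈span extend (suc l))

  r∈span-extend : s * e ≃ 1ℝ → r ∈ˢ span extend
  r∈span-extend se≃1 = member-resp (span extend) rescale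
    (scaling-closed (span extend) s (generator∈span extend zero))
    where
    rescale : (λ j → s * (e * r j)) ≋ r
    rescale j = begin-equality
      s * (e * r j)    ≈⟨ ℝ-ring.*-assoc s e (r j) ⟨
      s * e * r j      ≈⟨ *-cong se≃1 (≃-refl {r j}) ⟩
      1ℝ * r j         ≈⟨ ℝ-ring.*-identityˡ (r j) ⟩
      r j              ∎

⊖-cancel : ∀ {d} (a p : ℝ^ d) → (λ j → p j + (a ⊖ p) j) ≋ a
⊖-cancel a p j = pointwise λ n → solve 2 (λ a p → p :+ (a :+ (:- p)) := a) ≡.refl (seq (a j) n) (seq (p j) n)

-- By `coords-linComb` the projection has the same inner products with `u` as `a`.
residual-⊥ : ∀ {m d} (u : Vector (ℝ^ d) m) → Orthonormal u → ∀ a l →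
  u l · (a ⊖ linComb (coords u a) u) ≃ 0ℝ
residual-⊥ u on a l = begin-equality
  u l · (a ⊖ p)        ≈⟨ ·-⊖ (u l) a p ⟩
  u l · a - u l · p    ≈⟨ +-cong (·-comm (u l) a) (-‿cong (≃-trans (·-comm (u l) p) (coords-linComb u on (coords u a) l))) ⟩
  a · u l - a · u l    ≈⟨ ℝ-ring.-‿inverseʳ (a · u l) ⟩
  0ℝ                   ∎
  where
  open ≤-Reasoning
  p = linComb (coords u a) u

-- The double negation covers the undecidable question whether the next
-- residual vanishes.
gram-schmidt : ∀ {k d} (w : Vector (ℝ^ d) k) → ¬ ¬ OrthonormalHull w
gram-schmidt {zero}      w ¬hull = ¬hull (0 , ℕ.z≤n , (λ ()) , (λ ()) , λ ())
gram-schmidt {suc k} {d} w ¬hull = gram-schmidt (w ∘ suc) step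
  where
  step : ¬ OrthonormalHull (w ∘ suc)
  step (m , m≤k , u , on , w∈) = ¬hull (m , ℕₚ.m≤n⇒m≤1+n m≤k , u , on , λ
      { zero    → decompose (span u) (coords u a , λ _ → ≃-refl)
                    (member-resp (span u) (≃-sym ∘ r≋0) (0-closed (span u)))
      ; (suc i) → w∈ i })
    where
    a = w zero
    p = linComb (coords u a) u
    r = a ⊖ p

    decompose : ∀ V → p ∈ˢ V → r ∈ˢ V → a ∈ˢ V
    decompose V p∈V r∈V = member-resp V (⊖-cancel a p) (+-closed V p∈V r∈V)

    extended : (∃[ s ] ∃[ e ] s * e ≃ 1ℝ × e * (e * (r · r)) ≃ 1ℝ) → OrthonormalHull w
    extended (s , e , se≃1 , unit) =
      suc m , ℕ.s≤s m≤k , u′ , extend-orthonormal u on r s e unit (residual-⊥ u on a) , λ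
        { zero    → decompose (span u′) (u⊆u′ (coords u a , λ _ → ≃-refl)) (r∈span-extend u on r s e se≃1)
        ; (suc i) → u⊆u′ (w∈ i) }
      where
      u′ = extend u on r s e
      u⊆u′ : ∀ {v} → v ∈ˢ span u → v ∈ˢ span u′
      u⊆u′ = span⊆span-extend u on r s e

    -- A positive `r · r` could be normalised and would extend `u` to a hull of `w`, against
    -- `¬hull`. Hence `r · r ≤ 0ℝ`, and this sum bounds the square of each entry.
    r≋0 : ∀ j → r j ≃ 0ℝ
    r≋0 j = square-zero (≤-trans (term≤sum (λ i → square-nonneg (r i)) j) (¬Positive⇒≤0 (¬hull ∘ extended ∘ normaliser (·-nonneg r))))

-- Eckart–Young

-- This is ‖Bx‖².
energy : ∀ {m d} → Matrix m d → ℝ^ d → ℝ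
energy B x = coords B x · coords B x

-- Both sides add the squares of all products `B i · u l`, by rows on the left and by columns on the
-- right. It turns the part of the rows captured by `u` into the sum that Ky Fan's inequality
-- bounds.
sum-coords : ∀ {m d k} (B : Matrix m d) (u : Vector (ℝ^ d) k) →
  ∑[ i < m ] (coords u (B i) · coords u (B i)) ≃ ∑[ l < k ] energy B (u l)
sum-coords B u = ≃-trans (∑-comm (λ i l → (B i · u l) * (B i · u l)))
  (sum-cong-≋ λ l → sum-cong-≋ λ i → *-cong (·-comm (B i) (u l)) (·-comm (B i) (u l)))

-- The vector `z` is `y` cut off or padded with zeros to length `m`, and the entries cut off vanish
-- by hypothesis.
rectangular-diagonal-norm : ∀ m {d} (y : ℝ^ d) → (∀ q → m ℕ.≤ toℕ q → y q ≃ 0ℝ) →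
  let z : ℝ^ m
      z p = ∑[ q < d ] (δ[ toℕ p , toℕ q ] * y q)
  in z · z ≃ y · y
rectangular-diagonal-norm zero y missing = ≃-sym (≃-trans (·-cong (λ _ → ≃-refl) (λ q → missing q ℕ.z≤n)) (·-zeroʳ y))
rectangular-diagonal-norm (suc m) {zero} y missing = ·-zeroʳ {suc m} (λ _ → 0ℝ)
rectangular-diagonal-norm (suc m) {suc d} y missing = +-cong
  (*-cong (sum-δ y zero) (sum-δ y zero))
  (≃-trans (sum-cong-≋ {m} λ p → *-cong (skip-first p) (skip-first p))
    (rectangular-diagonal-norm m (y ∘ suc) λ q m≤q → missing (suc q) (ℕ.s≤s m≤q)))
  where
  z : ℝ^ m
  z p = ∑[ q < d ] (δ[ toℕ p , toℕ q ] * y (suc q))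
  skip-first : ∀ p → 0ℝ * y zero + z p ≃ z p
  skip-first p = ≃-trans (+-cong (ℝ-ring.zeroˡ (y zero)) (≃-refl {z p})) (ℝ-ring.+-identityˡ (z p))

-- Termwise comparison of sums of different lengths: the first `k` terms of the long sums are paired
-- with the short sums `c` and `g`, the others are compared directly.
sum-split-≤ : ∀ {k d} (k≤d : k ℕ.≤ d) {f h : Vector ℝ d} {c g : Vector ℝ k} →
  (∀ j → f (inject≤ j k≤d) + c j ≤ g j + h (inject≤ j k≤d)) →
  (∀ q → k ℕ.≤ toℕ q → f q ≤ h q) →
  sum f + sum c ≤ sum g + sum h
sum-split-≤ {zero} k≤d {f} {h} top rest = begin
  sum f + 0ℝ    ≈⟨ ℝ-ring.+-comm (sum f) 0ℝ ⟩
  0ℝ + sum f    ≤⟨ +-mono-≤ (≤-refl {0ℝ}) (sum-mono (λ q → rest q ℕ.z≤n)) ⟩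
  0ℝ + sum h    ∎
  where open ≤-Reasoning
sum-split-≤ {suc k} {suc d} k≤d {f} {h} {c} {g} top rest = begin
  (f zero + F) + (c zero + C)    ≈⟨ +-interchange (f zero) F (c zero) C ⟩
  (f zero + c zero) + (F + C)    ≤⟨ +-mono-≤ (top zero) (sum-split-≤ (ℕ.s≤s⁻¹ k≤d) (top ∘ suc) (λ q k≤q → rest (suc q) (ℕ.s≤s k≤q))) ⟩
  (g zero + h zero) + (G + H)    ≈⟨ +-interchange (g zero) (h zero) G H ⟩
  (g zero + G) + (h zero + H)    ∎
  where
  open ≤-Reasoning
  F = sum (f ∘ suc)
  C = sum (c ∘ suc)
  G = sum (g ∘ suc)
  H = sum (h ∘ suc)

-- The fractional knapsack bound behind Ky Fan's maximum principle, by
-- comparison with the threshold weight c = s_{k-1}.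
weighted-sum≤top-sum : ∀ {k d} → 1 ℕ.≤ k → (k≤d : k ℕ.≤ d) (s t : Vector ℝ d) →
  (∀ q → 0ℝ ≤ s q) → (∀ p q → p Fin.≤ q → s q ≤ s p) →
  (∀ q → 0ℝ ≤ t q) → (∀ q → t q ≤ 1ℝ) → sum t ≤ ∑[ j < k ] 1ℝ →
  ∑[ q < d ] (s q * t q) ≤ ∑[ j < k ] s (inject≤ j k≤d)
weighted-sum≤top-sum {suc k′} {d} _ k≤d s t s≥0 s-dec t≥0 t≤1 ∑t≤k =
  +-cancelʳ-≤ (∑[ j < k ] (c * 1ℝ)) (begin
    ∑[ q < d ] (s q * t q) + ∑[ j < k ] (c * 1ℝ)
      ≤⟨ sum-split-≤ k≤d top rest ⟩
    S + ∑[ q < d ] (c * t q)      ≈⟨ +-cong (≃-refl {S}) (*-distribˡ-sum c t) ⟨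
    S + c * sum t                 ≤⟨ +-mono-≤ (≤-refl {S}) (*-monoˡ-≤ (s≥0 last) ∑t≤k) ⟩
    S + c * ∑[ j < k ] 1ℝ         ≈⟨ +-cong (≃-refl {S}) (*-distribˡ-sum {k} c (λ _ → 1ℝ)) ⟩
    S + ∑[ j < k ] (c * 1ℝ)       ∎)
  where
  open ≤-Reasoning
  k = suc k′
  -- The index k - 1, which exists because k ≥ 1.
  last : Fin d
  last = inject≤ (Fin.fromℕ k′) k≤d
  toℕ-last : toℕ last ≡ k′
  toℕ-last = ≡.trans (Finₚ.toℕ-inject≤ (Fin.fromℕ k′) k≤d) (Finₚ.toℕ-fromℕ k′)
  c = s last
  S = ∑[ j < k ] s (inject≤ j k≤d)
  top : ∀ j → s (inject≤ j k≤d) * t (inject≤ j k≤d) + c * 1ℝ ≤ s (inject≤ j k≤d) + c * t (inject≤ j k≤d)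
  top j = begin
    -- The slack is (s - c)(1 - t): among the first k indices the weight is at least the threshold
    -- and t is at most 1.
    s q * t q + c * 1ℝ    ≤⟨ ≤-+ (*-nonneg-ℝ (≤⇒0≤- c≤s) (≤⇒0≤- (t≤1 q))) ⟩
    s q * t q + c * 1ℝ + (s q - c) * (1ℝ - t q)
      ≈⟨ pointwise (λ n → solve 3 (λ s t c → s :* t :+ c :* con 1ℚ :+ (s :+ (:- c)) :* (con 1ℚ :+ (:- t)) := s :+ c :* t) ≡.refl (seq (s q) n) (seq (t q) n) (seq c n)) ⟩
    s q + c * t q         ∎
    where
    q = inject≤ j k≤d
    c≤s : c ≤ s q
    c≤s = s-dec q last (≡.subst₂ ℕ._≤_ (≡.sym (Finₚ.toℕ-inject≤ j k≤d)) (≡.sym toℕ-last) (Finₚ.toℕ≤pred[n] j))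
  rest : ∀ q → k ℕ.≤ toℕ q → s q * t q ≤ c * t q
  rest q k≤q = begin
    s q * t q    ≈⟨ ℝ-ring.*-comm (s q) (t q) ⟩
    t q * s q    ≤⟨ *-monoˡ-≤ (t≥0 q) (s-dec last q (≡.subst (ℕ._≤ toℕ q) (≡.sym toℕ-last) (ℕₚ.<⇒≤ k≤q))) ⟩
    t q * c      ≈⟨ ℝ-ring.*-comm (t q) c ⟩
    c * t q      ∎

module _ {m d} {B : Matrix m d} (svd : FullSVD B) where
  open FullSVD svd
  open ≤-Reasoning

  -- Write B = UΣWᵀ. Then Bx is U applied to ΣWᵀx, and U preserves norms. In the proof `y` lists the
  -- products σ_q⟨x, r_q⟩ with length `d`, and `z` is ΣWᵀx with length `m`.
  energy-svd : ∀ x → energy B x ≃ ∑[ q < d ] ((σ q * σ q) * ((x · rightVector q) * (x · rightVector q)))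
  energy-svd x = begin-equality
    coords B x · coords B x                        ≈⟨ ·-cong image image ⟩
    linComb z leftVector · linComb z leftVector    ≈⟨ linComb-isometry leftVector left-orthonormal z ⟩
    z · z                                          ≈⟨ rectangular-diagonal-norm m y (λ q m≤q → ≃-trans (*-cong (σ-missing q m≤q) (≃-refl {x · rightVector q})) (ℝ-ring.zeroˡ _)) ⟩
    y · y                                          ≈⟨ sum-cong-≋ (λ q → *-interchange (σ q) (x · rightVector q) (σ q) (x · rightVector q)) ⟩
    ∑[ q < d ] ((σ q * σ q) * ((x · rightVector q) * (x · rightVector q))) ∎
    where
    y : ℝ^ d
    y q = σ q * (x · rightVector q)
    z : ℝ^ m
    z p = ∑[ q < d ] (δ[ toℕ p , toℕ q ] * y q)
    Σ-row : Fin m → ℝ^ d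
    Σ-row p q = δ[ toℕ p , toℕ q ] * σ q
    row : ∀ i → B i ≋ linComb (λ p → leftVector p i) (λ p → linComb (Σ-row p) rightVector)
    row i j = ≃-trans (decomposition i j) (sum-cong-≋ λ p → ≃-trans
      (sum-cong-≋ λ q → ℝ-ring.*-assoc (leftVector p i) (Σ-row p q) (rightVector q j))
      (≃-sym (*-distribˡ-sum (leftVector p i) (λ q → Σ-row p q * rightVector q j))))
    image : coords B x ≋ linComb z leftVector
    image i = begin-equality
      x · B i
        ≈⟨ ·-cong (λ _ → ≃-refl) (row i) ⟩
      x · linComb (λ p → leftVector p i) (λ p → linComb (Σ-row p) rightVector)
        ≈⟨ ·-linComb x (λ p → leftVector p i) (λ p → linComb (Σ-row p) rightVector) ⟩
      ∑[ p < m ] (leftVector p i * (x · linComb (Σ-row p) rightVector))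
        ≈⟨ sum-cong-≋ (λ p → ≃-trans
             (*-cong (≃-refl {leftVector p i}) (≃-trans (·-linComb x (Σ-row p) rightVector)
               (sum-cong-≋ λ q → ℝ-ring.*-assoc δ[ toℕ p , toℕ q ] (σ q) (x · rightVector q))))
             (ℝ-ring.*-comm (leftVector p i) (z p))) ⟩
      linComb z leftVector i ∎

  energy-rightVector : ∀ p → energy B (rightVector p) ≃ σ p * σ p
  energy-rightVector p = begin-equality
    energy B (rightVector p)
      ≈⟨ energy-svd (rightVector p) ⟩
    ∑[ q < d ] ((σ q * σ q) * ((rightVector p · rightVector q) * (rightVector p · rightVector q)))
      ≈⟨ sum-cong-≋ (λ q → ≃-trans
           (*-cong (≃-refl {σ q * σ q}) (≃-trans (*-cong (right-orthonormal p q) (right-orthonormal p q)) (δ-idem (toℕ p) (toℕ q))))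
           (ℝ-ring.*-comm (σ q * σ q) δ[ toℕ p , toℕ q ])) ⟩
    ∑[ q < d ] (δ[ toℕ p , toℕ q ] * (σ q * σ q))
      ≈⟨ sum-δ (λ q → σ q * σ q) p ⟩
    σ p * σ p ∎

  ky-fan : ∀ {k l} → 1 ℕ.≤ k → (k≤d : k ℕ.≤ d) → l ℕ.≤ k → (u : Vector (ℝ^ d) l) → Orthonormal u →
    ∑[ i < l ] energy B (u i) ≤ ∑[ j < k ] energy B (rightVector (inject≤ j k≤d))
  ky-fan {k} {l} 1≤k k≤d l≤k u on = begin
    ∑[ i < l ] energy B (u i)
      ≈⟨ sum-cong-≋ (λ i → energy-svd (u i)) ⟩
    ∑[ i < l ] ∑[ q < d ] (s q * (x i q * x i q))
      ≈⟨ ∑-comm (λ i q → s q * (x i q * x i q)) ⟩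
    ∑[ q < d ] ∑[ i < l ] (s q * (x i q * x i q))
      ≈⟨ sum-cong-≋ (λ q → *-distribˡ-sum (s q) (λ i → x i q * x i q)) ⟨
    ∑[ q < d ] (s q * t q)
      ≤⟨ weighted-sum≤top-sum 1≤k k≤d s t (λ q → square-nonneg (σ q))
           (λ p q p≤q → square-mono (σ-nonneg q) (σ-decreasing p q p≤q))
           (λ q → sum-nonneg λ i → square-nonneg (x i q)) t≤1 ∑t≤k ⟩
    ∑[ j < k ] s (inject≤ j k≤d)
      ≈⟨ sum-cong-≋ (λ j → energy-rightVector (inject≤ j k≤d)) ⟨
    ∑[ j < k ] energy B (rightVector (inject≤ j k≤d)) ∎
    where
    s : Vector ℝ d
    s q = σ q * σ q
    x : Fin l → Fin d → ℝ
    x i q = u i · rightVector q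
    t : Vector ℝ d
    t q = ∑[ i < l ] (x i q * x i q)
    -- Bessel for `u` at the unit vector `rightVector q`; in `∑t≤k` the roles are exchanged, with
    -- Bessel for the right singular vectors at each `u i`.
    t≤1 : ∀ q → t q ≤ 1ℝ
    t≤1 q = begin
      t q                                                      ≈⟨ ·-cong (λ i → ·-comm (u i) (rightVector q)) (λ i → ·-comm (u i) (rightVector q)) ⟩
      coords u (rightVector q) · coords u (rightVector q)      ≤⟨ bessel u on (rightVector q) ⟩
      rightVector q · rightVector q                            ≈⟨ ≃-trans (right-orthonormal q q) (δ-diag (toℕ q)) ⟩
      1ℝ                                                       ∎
    ∑t≤k : sum t ≤ ∑[ j < k ] 1ℝ
    ∑t≤k = begin
      ∑[ q < d ] ∑[ i < l ] (x i q * x i q)    ≈⟨ ∑-comm (λ q i → x i q * x i q) ⟩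
      ∑[ i < l ] ∑[ q < d ] (x i q * x i q)    ≤⟨ sum-mono (λ i → ≤-trans (bessel rightVector right-orthonormal (u i)) (≤-reflexive (≃-trans (on i i) (δ-diag (toℕ i))))) ⟩
      ∑[ i < l ] 1ℝ                            ≤⟨ sum-ones-mono l≤k ⟩
      ∑[ j < k ] 1ℝ                            ∎

  top-orthonormal : ∀ {k} (k≤d : k ℕ.≤ d) → Orthonormal (λ j → rightVector (inject≤ {k} j k≤d))
  top-orthonormal k≤d i j = ≃-trans (right-orthonormal (inject≤ i k≤d) (inject≤ j k≤d))
    (≃-reflexive (≡.cong₂ δ[_,_] (Finₚ.toℕ-inject≤ i k≤d) (Finₚ.toℕ-inject≤ j k≤d)))

  -- For projections onto `r`, residual plus captured energy is exactly the squared Frobenius norm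
  -- of `B`. For points in the span of `u` the residual plus the energy captured by `u` is at least
  -- that norm. Ky Fan compares the two energies, and the energy of `r` cancels.
  eckart-young : ∀ {k} → 1 ℕ.≤ k → (k≤d : k ℕ.≤ d) (w : Vector (ℝ^ d) k) (v : Vector (ℝ^ d) m) →
    (∀ i → v i ∈ˢ span w) →
    let r = λ j → rightVector (inject≤ j k≤d)
        p = λ i → linComb (coords r (B i)) r
    in ∑[ i < m ] ((B i ⊖ p i) · (B i ⊖ p i)) ≤ ∑[ i < m ] ((B i ⊖ v i) · (B i ⊖ v i))
  -- The goal is an inequality of reals, so `≤-stable` gives access to the family from
  -- `gram-schmidt`.
  eckart-young {k} 1≤k k≤d w v v∈w = ≤-stable λ ≰ → gram-schmidt w λ (l , l≤k , u , on , w∈u) →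
    ≰ (+-cancelʳ-≤ (∑[ j < k ] energy B (r j)) (begin
      P + ∑[ j < k ] energy B (r j)
        ≈⟨ +-cong (≃-refl {P}) (sum-coords B r) ⟨
      P + ∑[ i < m ] (coords r (B i) · coords r (B i))
        ≈⟨ ∑-distrib-+ (λ i → (B i ⊖ p i) · (B i ⊖ p i)) (λ i → coords r (B i) · coords r (B i)) ⟨
      ∑[ i < m ] ((B i ⊖ p i) · (B i ⊖ p i) + coords r (B i) · coords r (B i))
        ≈⟨ sum-cong-≋ (λ i → projection r (top-orthonormal k≤d) (B i)) ⟩
      ∑[ i < m ] (B i · B i)
        ≤⟨ sum-mono (λ i → projection-optimal u on (B i) (span⊆ w (span u) w∈u (v∈w i))) ⟩
      ∑[ i < m ] ((B i ⊖ v i) · (B i ⊖ v i) + coords u (B i) · coords u (B i))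
        ≈⟨ ∑-distrib-+ (λ i → (B i ⊖ v i) · (B i ⊖ v i)) (λ i → coords u (B i) · coords u (B i)) ⟩
      Q + ∑[ i < m ] (coords u (B i) · coords u (B i))
        ≈⟨ +-cong (≃-refl {Q}) (sum-coords B u) ⟩
      Q + ∑[ i < l ] energy B (u i)
        ≤⟨ +-mono-≤ (≤-refl {Q}) (ky-fan 1≤k k≤d l≤k u on) ⟩
      Q + ∑[ j < k ] energy B (r j) ∎))
    where
    r : Vector (ℝ^ d) k
    r j = rightVector (inject≤ j k≤d)
    p : Vector (ℝ^ d) m
    p i = linComb (coords r (B i)) r
    P = ∑[ i < m ] ((B i ⊖ p i) · (B i ⊖ p i))
    Q = ∑[ i < m ] ((B i ⊖ v i) · (B i ⊖ v i))

-- From the Frobenius bound on the coreset to the maximal distance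

-- The increasing enumeration of `S`, by the same recursion as `_↾_`.
row-index : ∀ {n} (S : Subset n) → Fin ∣ S ∣ → Fin n
row-index (inside ∷ S)  zero    = zero
row-index (inside ∷ S)  (suc i) = suc (row-index S i)
row-index (outside ∷ S) i       = suc (row-index S i)

row-index∈ : ∀ {n} (S : Subset n) i → row-index S i ∈ S
row-index∈ (inside ∷ S)  zero    = here
row-index∈ (inside ∷ S)  (suc i) = there (row-index∈ S i)
row-index∈ (outside ∷ S) i       = there (row-index∈ S i)

↾-row : ∀ {n d} (A : Matrix n d) S i → (A ↾ S) i ≡ A (row-index S i)
↾-row A (inside ∷ S)  zero    = ≡.refl
↾-row A (inside ∷ S)  (suc i) = ↾-row (A ∘ suc) S i
↾-row A (outside ∷ S) i       = ↾-row (A ∘ suc) S i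

row-index-surjective : ∀ {n} (S : Subset n) {i} → i ∈ S → ∃[ j ] row-index S j ≡ i
row-index-surjective (inside ∷ S)  here        = zero , ≡.refl
row-index-surjective (inside ∷ S)  (there i∈S) = let j , eq = row-index-surjective S i∈S in suc j , ≡.cong suc eq
row-index-surjective (outside ∷ S) (there i∈S) = let j , eq = row-index-surjective S i∈S in j , ≡.cong suc eq

maxOver-nonneg : ∀ {n} (S : Subset n) f → 0ℝ ≤ maxOver S f
maxOver-nonneg []            f = ≤-refl
maxOver-nonneg (inside ∷ S)  f = ≤-trans (maxOver-nonneg S (f ∘ suc)) (y≤x⊔y (f zero) (maxOver S (f ∘ suc)))
maxOver-nonneg (outside ∷ S) f = maxOver-nonneg S (f ∘ suc)

maxOver-upper : ∀ {n} (S : Subset n) f {i} → i ∈ S → f i ≤ maxOver S f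
maxOver-upper (inside ∷ S)  f here        = x≤x⊔y (f zero) (maxOver S (f ∘ suc))
maxOver-upper (inside ∷ S)  f (there i∈S) = ≤-trans (maxOver-upper S (f ∘ suc) i∈S) (y≤x⊔y (f zero) (maxOver S (f ∘ suc)))
maxOver-upper (outside ∷ S) f (there i∈S) = maxOver-upper S (f ∘ suc) i∈S

-- The hypothesis `0ℝ ≤ b` accounts for the value 0 from which the fold starts.
maxOver-lub : ∀ {n} (S : Subset n) f {b} → 0ℝ ≤ b → (∀ i → i ∈ S → f i ≤ b) → maxOver S f ≤ b
maxOver-lub []            f b≥0 h = b≥0
maxOver-lub (inside ∷ S)  f b≥0 h = ⊔-lub (h zero here) (maxOver-lub S (f ∘ suc) b≥0 λ i i∈S → h (suc i) (there i∈S))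
maxOver-lub (outside ∷ S) f b≥0 h = maxOver-lub S (f ∘ suc) b≥0 λ i i∈S → h (suc i) (there i∈S)

norm-square : ∀ {d} (v : ℝ^ d) → ‖ v ‖ * ‖ v ‖ ≃ v · v
norm-square v = √-square (v · v) (·-nonneg v)

distance-nonneg : ∀ {d} {a : ℝ^ d} {V r} → IsDistance a V r → 0ℝ ≤ r
distance-nonneg {a = a} ((v , _ , r≃) , _) = ≤-trans (√-nonneg ((a ⊖ v) · (a ⊖ v))) (≤-reflexive (≃-sym r≃))

distance-square-≤ : ∀ {d} {a : ℝ^ d} {V r} → IsDistance a V r → ∀ v → v ∈ˢ V → r * r ≤ (a ⊖ v) · (a ⊖ v)
distance-square-≤ {a = a} {V} {r} dist@(_ , least) v v∈V = begin
  r * r                        ≤⟨ square-mono (distance-nonneg {a = a} {V} dist) (least ‖ a ⊖ v ‖ (v , v∈V , ≃-refl)) ⟩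
  ‖ a ⊖ v ‖ * ‖ a ⊖ v ‖        ≈⟨ norm-square (a ⊖ v) ⟩
  (a ⊖ v) · (a ⊖ v)            ∎
  where open ≤-Reasoning

top-hasDim : ∀ {m d k} {B : Matrix m d} (svd : FullSVD B) (k≤d : k ℕ.≤ d) →
  topRightSingularSubspace svd k≤d HasDim k
top-hasDim svd k≤d = r , generator∈span r , orthonormal⇒independent r (top-orthonormal svd k≤d) , λ _ v∈ → v∈
  where r = λ j → FullSVD.rightVector svd (inject≤ j k≤d)

module _ {k d n} (1≤k : 1 ℕ.≤ k) (k≤d : k ℕ.≤ d) (A : Matrix n d) (S : Subset n) (svd : FullSVD (A ↾ S))
         (V : Subspace d) (dim : V HasDim k) (x y : Vector ℝ n)
         (x-dist : ∀ i → i ∈ S → IsDistance (A i) (topRightSingularSubspace svd k≤d) (x i))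
         (y-dist : ∀ i → i ∈ S → IsDistance (A i) V (y i)) where
  open ≤-Reasoning

  row-distance : ∀ (W : Subspace d) (z : Vector ℝ n) → (∀ i → i ∈ S → IsDistance (A i) W (z i)) →
    ∀ i → IsDistance ((A ↾ S) i) W (z (row-index S i))
  row-distance W z dist i = ≡.subst (λ a → IsDistance a W (z (row-index S i)))
    (≡.sym (↾-row A S i)) (dist (row-index S i) (row-index∈ S i))

  -- The distances to Ṽ are at most the residuals at the projections `p i`, which lie in Ṽ. The
  -- distances to `V` are attained at points `v i`, and Eckart-Young compares the two families of
  -- residuals.
  sum-distance-squares-≤ : ∑[ i < ∣ S ∣ ] (x (row-index S i) * x (row-index S i)) ≤
                           ∑[ i < ∣ S ∣ ] (y (row-index S i) * y (row-index S i))
  sum-distance-squares-≤ = begin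
    ∑[ i < ∣ S ∣ ] (x (row-index S i) * x (row-index S i))
      ≤⟨ sum-mono (λ i → distance-square-≤ {a = B i} {Ṽ} (row-distance Ṽ x x-dist i) (p i) (coords r (B i) , λ _ → ≃-refl)) ⟩
    ∑[ i < ∣ S ∣ ] ((B i ⊖ p i) · (B i ⊖ p i))
      -- The nested projections of `dim` select the clause that the basis spans `V`.
      ≤⟨ eckart-young svd 1≤k k≤d (proj₁ dim) v (λ i → proj₂ (proj₂ (proj₂ dim)) (v i) (proj₁ (proj₂ (nearest i)))) ⟩
    ∑[ i < ∣ S ∣ ] ((B i ⊖ v i) · (B i ⊖ v i))
      ≈⟨ sum-cong-≋ (λ i → ≃-trans (*-cong (proj₂ (proj₂ (nearest i))) (proj₂ (proj₂ (nearest i)))) (norm-square (B i ⊖ v i))) ⟨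
    ∑[ i < ∣ S ∣ ] (y (row-index S i) * y (row-index S i)) ∎
    where
    B = A ↾ S
    Ṽ = topRightSingularSubspace svd k≤d
    r : Vector (ℝ^ d) k
    r j = FullSVD.rightVector svd (inject≤ j k≤d)
    p : Vector (ℝ^ d) ∣ S ∣
    p i = linComb (coords r (B i)) r
    nearest : ∀ i → ∃[ v ] v ∈ˢ V × y (row-index S i) ≃ ‖ B i ⊖ v ‖
    nearest i = proj₁ (row-distance V y y-dist i)
    v : Vector (ℝ^ d) ∣ S ∣
    v i = proj₁ (nearest i)

  -- After squaring, one term is at most the whole sum of squared distances to Ṽ. That sum is at
  -- most the one for `V`, hence at most |S|b², the square of the bound.
  maxOver-distance-≤ : ∀ {b} → 0ℝ ≤ b → (∀ i → i ∈ S → y i ≤ b) → maxOver S x ≤ √ (fromℕ ∣ S ∣) * b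
  maxOver-distance-≤ {b} b≥0 y≤b = maxOver-lub S x bound≥0 λ i i∈S →
    let j , eq = row-index-surjective S i∈S
    in ≡.subst (λ i → x i ≤ bound) eq (square-cancel-≤-ℝ bound≥0 (begin
      x (row-index S j) * x (row-index S j)
        ≤⟨ term≤sum (λ j → square-nonneg (x (row-index S j))) j ⟩
      ∑[ j < ∣ S ∣ ] (x (row-index S j) * x (row-index S j))
        ≤⟨ sum-distance-squares-≤ ⟩
      ∑[ j < ∣ S ∣ ] (y (row-index S j) * y (row-index S j))
        ≤⟨ sum-mono (λ j → square-mono (distance-nonneg {a = A (row-index S j)} {V} (y-dist (row-index S j) (row-index∈ S j))) (y≤b (row-index S j) (row-index∈ S j))) ⟩
      ∑[ j < ∣ S ∣ ] (b * b)
        ≈⟨ sum-cong-≋ {∣ S ∣} (λ _ → ℝ-ring.*-identityˡ (b * b)) ⟨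
      ∑[ j < ∣ S ∣ ] (1ℝ * (b * b))
        ≈⟨ *-distribʳ-sum {∣ S ∣} (b * b) (λ _ → 1ℝ) ⟨
      ∑[ j < ∣ S ∣ ] 1ℝ * (b * b)
        ≈⟨ *-cong (≃-trans (sum-ones ∣ S ∣) (≃-sym (√-square N (≤-pointwise {0ℝ} {N} λ _ → ι-nonneg ∣ S ∣)))) (≃-refl {b * b}) ⟩
      √ N * √ N * (b * b)
        ≈⟨ *-interchange (√ N) (√ N) b b ⟩
      bound * bound ∎))
    where
    N = fromℕ ∣ S ∣
    bound = √ N * b
    bound≥0 : 0ℝ ≤ bound
    bound≥0 = *-nonneg-ℝ (√-nonneg N) b≥0

mainTheorem6 : ∀ (k d n : ℕ) → 1 ℕ.≤ k → (k≤d : k ℕ.≤ d) → 1 ℕ.≤ n →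
    (A : Matrix n d) (S : Subset n) (β : ℝ) → 1ℝ ≤ β →
    (∀ (V : Subspace d) → V HasDim k →
    ∀ s t → IsMaxDistance A S V s → IsMaxDistance A ⊤ V t → s ≤ t × t ≤ β * s) →
    (svd : FullSVD (A ↾ S)) →
    (∀ x opt → IsMaxDistance A ⊤ (topRightSingularSubspace svd k≤d) x →
    IsMinimum (Objective A k) opt → x ≤ (β * √ (fromℕ ∣ S ∣)) * opt)
    × IsApproximateSolution (β * √ (fromℕ ∣ S ∣)) A k (topRightSingularSubspace svd k≤d)
mainTheorem6 k d n 1≤k k≤d 1≤n A S β 1≤β coreset svd =
    -- A minimum is itself an objective value, so the first claim is an instance of near-optimality.
    (λ x opt x-max (opt-objective , _) → near-optimal x opt x-max opt-objective)
  , record { dimension = top-hasDim svd k≤d ; near-optimal = near-optimal }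
  where
  open ≤-Reasoning
  Ṽ = topRightSingularSubspace svd k≤d
  N = fromℕ ∣ S ∣

  near-optimal : ∀ x y → IsMaxDistance A ⊤ Ṽ x → Objective A k y → x ≤ (β * √ N) * y
  near-optimal x y x-max@(ξ , ξ-dist , _) (V , dim , η , η-dist , y≃) = begin
    x
      -- The coreset property at Ṽ, with the maximum over `S` taken of the same distances ξ.
      ≤⟨ proj₂ (coreset Ṽ (top-hasDim svd k≤d) (maxOver S ξ) x (ξ , (λ i _ → ξ-dist i ∈⊤) , ≃-refl) x-max) ⟩
    β * maxOver S ξ
      -- The bound `b` is `y`, which as the maximum over all rows dominates the distances of the
      -- rows in `S`.
      ≤⟨ *-monoˡ-≤ (≤-trans (≤-pointwise {0ℝ} {1ℝ} λ _ → ℚₚ.<⇒≤ 1>0) 1≤β)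
           (maxOver-distance-≤ 1≤k k≤d A S svd V dim ξ η (λ i _ → ξ-dist i ∈⊤) (λ i _ → η-dist i ∈⊤) y≥0 η≤y) ⟩
    β * (√ N * y)
      ≈⟨ ℝ-ring.*-assoc β (√ N) y ⟨
    (β * √ N) * y ∎
    where
    y≥0 : 0ℝ ≤ y
    y≥0 = ≤-trans (maxOver-nonneg ⊤ η) (≤-reflexive (≃-sym y≃))
    η≤y : ∀ i → i ∈ S → η i ≤ y
    η≤y i _ = ≤-trans (maxOver-upper ⊤ η ∈⊤) (≤-reflexive (≃-sym y≃))
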